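{- The optimal pebbling number of the $n$-dimensional hypercube $Q_n$ satisfies \[ o(Q_n)=\Theta\!\left(\left(\tfrac43\right)^n\right)\qquad (n\to\infty). \]
   Context: $Q_n$ is the $n$-dimensional hypercube graph: its vertices are the $0/1$ strings of length $n$, two being adjacent when they differ in exactly one coordinate. A pebbling distribution $D$ on a graph $G$ assigns a nonnegative integer number $D(v)$ of pebbles to each vertex $v$; its size is $|D|=\sum_v D(v)$. A pebbling move removes two pebbles from one vertex and places one pebble on an adjacent vertex. A distribution is solvable if, for every target vertex, some (possibly empty) sequence of pebbling moves starting from $D$ places at least one pebble on the target. The optimal pebbling number $o(G)$ is the minimum size of a solvable distribution on $G$. -}

module Defs where

open import Data.Bool.Base using (Bool; if_then_else_)
import Data.Bool.Properties as Bool
open import Data.Fin.Base using (Fin; zero; suc; toℕ; fromℕ<; punchIn; finToFun; funToFin)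
open import Data.Fin.Properties as Fin
  using (any?; all?; *↔×; 2↔Bool; punchInᵢ≢i; finToFun-funToFin; toℕ-fromℕ<)
import Data.Integer.Base as ℤ
open import Data.Nat.Base using (ℕ; zero; suc; _+_; _*_; _∸_; _≤_; _<_; _^_; z≤n; s≤s; s≤s⁻¹)
open import Data.Nat.Induction using (<-wellFounded)
import Data.Nat.Properties as ℕ
open import Data.Product using (∃; ∃₂; ∃!; _×_; _,_; proj₁; proj₂)
open import Data.Product.Function.NonDependent.Propositional using (_×-↔_)
open import Data.Rational.Base as ℚ using (ℚ; 0ℚ)
import Data.Rational.Properties as ℚ
open import Data.Sum.Base using (inj₁; inj₂)
open import Data.Vec.Base using (Vec; []; _∷_; lookup)
open import Function.Base using (_∘_)
open import Function.Bundles using (_↔_; Inverse; mk↔ₛ′)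
open import Function.Construct.Composition using (_↔-∘_)
open import Function.Construct.Symmetry using (↔-sym)
open import Function.Properties.Inverse using (↔⇒↣)
open import Induction.WellFounded using (Acc; acc)
open import Relation.Binary.Construct.Closure.ReflexiveTransitive using (Star; ε; _◅_)
open import Relation.Binary.Definitions using (Decidable; DecidableEquality; Irreflexive; Symmetric)
open import Relation.Binary.PropositionalEquality
open import Relation.Nullary using (¬_; Dec; yes; no; contradiction)
open import Relation.Nullary.Decidable using (does; map′; via-injection; ¬?; _×-dec_; _→-dec_; dec-true; dec-false)
import Relation.Unary as Pred

open import Algebra.Bundles using (CommutativeRing)
open import Algebra.Properties.CommutativeMonoid.Sum ℕ.+-0-commutativeMonoid
  using (sum; sum-remove; sum-cong-≗; ∑-distrib-+; sum-replicate-zero)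
open import Algebra.Properties.Semiring.Exp (CommutativeRing.semiring ℚ.+-*-commutativeRing) public
  using () renaming (_^_ to _^ℚ_)

record FiniteGraph : Set₁ where
  infix 4 _~_ _~?_ _≟_
  field
    Vertex : Set
    order  : ℕ
    enum   : Vertex ↔ Fin order
    _~_    : Vertex → Vertex → Set
    _~?_   : Decidable _~_
    ~-sym    : Symmetric _~_
    ~-irrefl : Irreflexive _≡_ _~_

  index : Vertex → Fin order
  index = Inverse.to enum

  vertex : Fin order → Vertex
  vertex = Inverse.from enum

  index-vertex : ∀ i → index (vertex i) ≡ i
  index-vertex = Inverse.strictlyInverseˡ enum

  vertex-index : ∀ v → vertex (index v) ≡ v
  vertex-index = Inverse.strictlyInverseʳ enum

  _≟_ : DecidableEquality Vertex
  _≟_ = via-injection (↔⇒↣ enum) Fin._≟_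

module Pebbling (G : FiniteGraph) where
  open FiniteGraph G

  Distribution : Set
  Distribution = Vertex → ℕ

  size : Distribution → ℕ
  size D = sum (D ∘ vertex)

  δ : Vertex → Distribution
  δ u w = if does (u ≟ w) then 1 else 0

  moveAlong : Vertex → Vertex → Distribution → Distribution
  moveAlong u v D w = (D w ∸ 2 * δ u w) + δ v w

  infix 4 _⟶_
  data _⟶_ (D : Distribution) : Distribution → Set where
    move : ∀ {u v} → u ~ v → 2 ≤ D u → D ⟶ moveAlong u v D

  Reachable : Distribution → Vertex → Set
  Reachable D t = ∃ λ D′ → Star _⟶_ D D′ × 1 ≤ D′ t

  Solvable : Distribution → Set
  Solvable D = ∀ t → Reachable D t

  HasSolvableOfSize : ℕ → Set
  HasSolvableOfSize k = ∃ λ D → Solvable D × size D ≡ k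

  IsOptimal : ℕ → Set
  IsOptimal k = HasSolvableOfSize k × (∀ D → Solvable D → k ≤ size D)

  -- Constructively, the minimum has to be computed.  Reachability is decidable
  -- because every move decreases the size, and there are finitely many
  -- distributions of each size.

  δ-same : ∀ u → δ u u ≡ 1
  δ-same u = cong (if_then 1 else 0) (dec-true (u ≟ u) refl)

  δ-diff : ∀ {u w} → u ≢ w → δ u w ≡ 0
  δ-diff {u} {w} u≢w = cong (if_then 1 else 0) (dec-false (u ≟ w) u≢w)

  vertex-injective : ∀ {i j} → vertex i ≡ vertex j → i ≡ j
  vertex-injective {i} {j} eq =
    trans (sym (index-vertex i)) (trans (cong index eq) (index-vertex j))

  sum-δ : ∀ {n} (f : Fin n → ℕ) i → f i ≡ 1 → (∀ j → j ≢ i → f j ≡ 0) → sum f ≡ 1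
  sum-δ {suc n} f i fi≡1 rest = trans (sum-remove {i = i} f) (cong₂ _+_ fi≡1
    (trans (sum-cong-≗ (λ j → rest (punchIn i j) (punchInᵢ≢i i j))) (sum-replicate-zero n)))

  size-δ : ∀ u → size (δ u) ≡ 1
  size-δ u = sum-δ (δ u ∘ vertex) (index u)
    (trans (cong (δ u) (vertex-index u)) (δ-same u))
    (λ j j≢i → δ-diff (λ u≡vj → j≢i (trans (sym (index-vertex j)) (cong index (sym u≡vj)))))

  2δ≤ : ∀ {D : Distribution} {u} → 2 ≤ D u → ∀ w → 2 * δ u w ≤ D w
  2δ≤ {D} {u} 2≤Du w = helper (u ≟ w)
    where
    helper : Dec (u ≡ w) → 2 * δ u w ≤ D w
    helper (yes refl) = subst (λ x → 2 * x ≤ D u) (sym (δ-same u)) 2≤Du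
    helper (no u≢w)   = subst (λ x → 2 * x ≤ D w) (sym (δ-diff u≢w)) z≤n

  size-move : ∀ {D : Distribution} {u} v → 2 ≤ D u → size (moveAlong u v D) < size D
  size-move {D} {u} v 2≤Du = begin-strict
    size (moveAlong u v D)              ≡⟨ ∑-distrib-+ (E ∘ vertex) (δ v ∘ vertex) ⟩
    size E + size (δ v)                 ≡⟨ cong (size E +_) (size-δ v) ⟩
    size E + 1                          <⟨ ℕ.+-monoʳ-< (size E) (s≤s (s≤s z≤n)) ⟩
    size E + 2                          ≡⟨ cong (size E +_) (sym size-2δ) ⟩
    size E + size (λ w → 2 * δ u w)     ≡⟨ sym (∑-distrib-+ (E ∘ vertex) _) ⟩
    size (λ w → E w + 2 * δ u w)        ≡⟨ sum-cong-≗ (λ i → ℕ.m∸n+n≡m (2δ≤ {D} {u} 2≤Du (vertex i))) ⟩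
    size D                              ∎
    where
    open ℕ.≤-Reasoning
    E : Distribution
    E w = D w ∸ 2 * δ u w
    size-2δ : size (λ w → 2 * δ u w) ≡ 2
    size-2δ = trans (∑-distrib-+ (δ u ∘ vertex) _)
      (cong₂ _+_ (size-δ u) (trans (∑-distrib-+ (δ u ∘ vertex) (λ _ → 0))
        (cong₂ _+_ (size-δ u) (sum-replicate-zero order))))

  any-vertex? : {P : Vertex → Set} → Pred.Decidable P → Dec (∃ P)
  any-vertex? {P} P? = map′ (λ (i , p) → vertex i , p)
    (λ (v , p) → index v , subst P (sym (vertex-index v)) p) (any? (P? ∘ vertex))

  all-vertices? : {P : Vertex → Set} → Pred.Decidable P → Dec (∀ v → P v)
  all-vertices? {P} P? = map′ (λ p v → subst P (vertex-index v) (p (index v)))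
    (λ p i → p (vertex i)) (all? (P? ∘ vertex))

  reachable?′ : ∀ D t → Acc _<_ (size D) → Dec (Reachable D t)
  reachable?′ D t (acc rec) with 1 ℕ.≤? D t
  ... | yes 1≤ = yes (D , ε , 1≤)
  ... | no 1≰ = map′ to from (any-vertex? λ u → any-vertex? λ v → step? u v)
    where
    Step : Vertex → Vertex → Set
    Step u v = u ~ v × 2 ≤ D u × Reachable (moveAlong u v D) t
    step? : ∀ u v → Dec (Step u v)
    step? u v with u ~? v | 2 ℕ.≤? D u
    ... | no ¬a | _ = no λ (a , _) → ¬a a
    ... | yes _ | no ¬b = no λ (_ , b , _) → ¬b b
    ... | yes a | yes b = map′ (λ r → a , b , r) (λ (_ , _ , r) → r)
      (reachable?′ (moveAlong u v D) t (rec (size-move {D} v b)))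
    to : ∃₂ Step → Reachable D t
    to (u , v , a , b , D′ , ms , p) = D′ , move a b ◅ ms , p
    from : Reachable D t → ∃₂ Step
    from (_ , ε , p) = contradiction p 1≰
    from (D′ , move {u} {v} a b ◅ ms , p) = u , v , a , b , D′ , ms , p

  solvable? : Pred.Decidable Solvable
  solvable? D = all-vertices? λ t → reachable?′ D t (<-wellFounded (size D))

  reachable-resp : ∀ {D E : Distribution} {t} → D ≗ E → Reachable D t → Reachable E t
  reachable-resp {E = E} {t} D≗E (_ , ε , p) = E , ε , subst (1 ≤_) (D≗E t) p
  reachable-resp D≗E (D′ , move {u} {v} a b ◅ ms , p)
    with reachable-resp (λ w → cong (λ x → (x ∸ 2 * δ u w) + δ v w) (D≗E w)) (D′ , ms , p)
  ... | E′ , ms′ , p′ = E′ , move a (subst (2 ≤_) (D≗E u) b) ◅ ms′ , p′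

  ≤-sum : ∀ {n} (f : Fin n → ℕ) i → f i ≤ sum f
  ≤-sum f zero = ℕ.m≤m+n _ _
  ≤-sum f (suc i) = ℕ.≤-trans (≤-sum (f ∘ suc) i) (ℕ.m≤n+m _ _)

  ≤-size : ∀ D w → D w ≤ size D
  ≤-size D w = subst (λ x → D x ≤ size D) (vertex-index w) (≤-sum (D ∘ vertex) (index w))

  decode : ∀ k → Fin (suc k ^ order) → Distribution
  decode k c w = toℕ (finToFun {suc k} {order} c (index w))

  encode : ∀ k D → size D ≡ k → ∃ λ c → D ≗ decode k c
  encode k D eq = funToFin f , λ w → sym (trans
      (cong toℕ (finToFun-funToFin f (index w)))
      (trans (toℕ-fromℕ< _) (cong D (vertex-index w))))
    where
    f : Fin order → Fin (suc k)
    f i = fromℕ< {D (vertex i)} (s≤s (subst (D (vertex i) ≤_) eq (≤-size D (vertex i))))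

  hasSolvableOfSize? : Pred.Decidable HasSolvableOfSize
  hasSolvableOfSize? k = map′ (λ (c , s) → decode k c , s) from
    (any? λ c → solvable? (decode k c) ×-dec (size (decode k c) ℕ.≟ k))
    where
    from : HasSolvableOfSize k → ∃ λ c → Solvable (decode k c) × size (decode k c) ≡ k
    from (D , s , eq) with encode k D eq
    ... | c , D≗ = c , (λ t → reachable-resp D≗ (s t))
                     , trans (sum-cong-≗ (λ i → sym (D≗ (vertex i)))) eq

  search : {P : ℕ → Set} → Pred.Decidable P → ∀ d m →
           (∀ j → j < m → ¬ P j) → P (m + d) →
           ∃ λ k → P k × (∀ j → P j → k ≤ j)
  search {P} P? d m below p with P? m
  ... | yes pm = m , pm , λ j pj → ℕ.≮⇒≥ λ j<m → below j j<m pj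
  search {P} P? zero m below p | no ¬pm = contradiction (subst P (ℕ.+-identityʳ m) p) ¬pm
  search {P} P? (suc d) m below p | no ¬pm =
    search P? d (suc m) below′ (subst P (ℕ.+-suc m d) p)
    where
    below′ : ∀ j → j < suc m → ¬ P j
    below′ j j<1+m with ℕ.m≤n⇒m<n∨m≡n (s≤s⁻¹ j<1+m)
    ... | inj₁ j<m = below j j<m
    ... | inj₂ refl = ¬pm

  onePerVertex : Distribution
  onePerVertex _ = 1

  optimum : ∃ IsOptimal
  optimum with search hasSolvableOfSize? (size onePerVertex) 0 (λ _ ())
                 (onePerVertex , (λ _ → onePerVertex , ε , s≤s z≤n) , refl)
  ... | k , has , least = k , has , λ D s → least (size D) (D , s , refl)

  optimalPebblingNumber : ℕ
  optimalPebblingNumber = proj₁ optimum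

  optimalPebblingNumber-isOptimal : IsOptimal optimalPebblingNumber
  optimalPebblingNumber-isOptimal = proj₂ optimum

open Pebbling public using (optimalPebblingNumber; optimalPebblingNumber-isOptimal)

DifferInExactlyOne : ∀ {n} → Vec Bool n → Vec Bool n → Set
DifferInExactlyOne x y = ∃! _≡_ λ i → lookup x i ≢ lookup y i

differ? : ∀ {n} → Decidable (DifferInExactlyOne {n})
differ? x y = map′ (λ (i , d , u) → i , d , λ {j} → u j) (λ (i , d , u) → i , d , λ j → u {j})
  (any? λ i → D? i ×-dec all? λ j → D? j →-dec (i Fin.≟ j))
  where
  D? : ∀ i → Dec (lookup x i ≢ lookup y i)
  D? i = ¬? (lookup x i Bool.≟ lookup y i)

strings : ∀ n → Vec Bool n ↔ Fin (2 ^ n)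
strings zero = mk↔ₛ′ (λ _ → zero) (λ _ → []) (λ { zero → refl }) (λ { [] → refl })
strings (suc n) = ↔-sym *↔× ↔-∘ ((↔-sym 2↔Bool ×-↔ strings n) ↔-∘ uncons)
  where
  uncons : Vec Bool (suc n) ↔ (Bool × Vec Bool n)
  uncons = mk↔ₛ′ (λ { (b ∷ x) → b , x }) (λ (b , x) → b ∷ x) (λ _ → refl) (λ { (_ ∷ _) → refl })

hypercube : ℕ → FiniteGraph
hypercube n = record
  { Vertex   = Vec Bool n
  ; order    = 2 ^ n
  ; enum     = strings n
  ; _~_      = DifferInExactlyOne
  ; _~?_     = differ?
  ; ~-sym    = λ (i , d , u) → i , d ∘ sym , λ e → u (e ∘ sym)
  ; ~-irrefl = λ { refl (_ , d , _) → d refl }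
  }

fromℕ : ℕ → ℚ
fromℕ k = ℤ.+ k ℚ./ 1

-- Absolute values are omitted, so this is the usual relation only for
-- eventually nonnegative f and g.  Rational constants lose no generality,
-- since a positive real has positive rationals below and above it.
infix 4 _∈Θ_
_∈Θ_ : (ℕ → ℚ) → (ℕ → ℚ) → Set
f ∈Θ g = ∃₂ λ c C → 0ℚ ℚ.< c × 0ℚ ℚ.< C × ∃ λ N → ∀ n → N ≤ n →
  c ℚ.* g n ℚ.≤ f n × f n ℚ.≤ C ℚ.* g n

{-# OPTIONS --safe #-}
module Submission where

-- Lower bound: give a pebble at v the weight 2 ^ (n ∸ dist v t).  No move
-- increases the total weight, and t is reachable only if it is at least 2 ^ n;
-- summing over t gives 4 ^ n ≤ |D| * 3 ^ n.
--
-- Upper bound: suppose that 2 ^ k copies of S solve Q_n, and that piles of 2 ^ b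
-- pebbles on a multiset E in Q_b send 2 ^ k pebbles to every vertex.  Then
-- 2 ^ b copies of E × S solve Q_(b+n), since each fibre over a point s of S can
-- deliver the 2 ^ k pebbles wanted at (t , s).  No pile of E is too far from t
-- to contribute a whole number 2 ^ (b ∸ dist) of pebbles, so nothing is lost to
-- rounding, and for b ∈ {k+1 , k+2} a random E has so many points that every t
-- receives nearly the average.  Each step thus costs (4/3) ^ b times a factor
-- below 1 + 1/(k(k+2)), and the product of these factors converges.

open import Defs
open import Data.Bool.Base using (Bool; true; false)
import Data.Bool.Properties as Bool
open import Data.Fin.Base using (Fin; zero; suc; _↑ˡ_; _↑ʳ_)
import Data.Fin.Properties as Fin
import Data.Integer.Base as ℤ
import Data.Integer.Properties as ℤ
open import Data.List.Base using (List; []; _∷_; _++_; map; concatMap; replicate; length)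
open import Data.List.Properties
  using (length-++; length-map; length-replicate; map-++; map-replicate; concatMap-++)
open import Data.Nat.Base as ℕ hiding (_/_)
open import Data.Nat.Coprimality as Coprimality using (1-coprimeTo)
open import Data.Nat.DivMod using (m≡m%n+[m/n]*n; m%n<n; m/n*n≤m)
open import Data.Nat.ListAction using (sum)
open import Data.Nat.Properties
open import Data.Nat.Tactic.RingSolver using (solve-∀)
open import Data.Product using (∃₂; ∃-syntax; _×_; _,_; proj₂)
open import Data.Rational.Base as ℚ using (ℚ; 1ℚ; mkℚ; *≤*)
import Data.Rational.Properties as ℚ
open import Data.Sum.Base using (inj₁; inj₂)
open import Data.Vec.Base as Vec using (Vec; []; _∷_; lookup)
open import Function.Base using (_∘_)
open import Relation.Binary.Construct.Closure.ReflexiveTransitive using (Star; ε; _◅_; _◅◅_)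
open import Relation.Binary.PropositionalEquality
open import Relation.Nullary using (contradiction)
open import Relation.Nullary.Decidable using (decidable-stable; toWitness)
open import Algebra.Bundles using (CommutativeRing)
open import Algebra.Properties.CommutativeMonoid.Sum +-0-commutativeMonoid
  using (sum-cong-≗; ∑-distrib-+; sum-replicate-zero) renaming (sum to sumᶠ)
open import Algebra.Properties.CommutativeSemigroup +-commutativeSemigroup using (x∙yz≈y∙xz; xy∙z≈y∙xz)

-- Sums over the vertices of the cube

-- Recursion on coordinates, unlike the enumeration behind `size`, makes sums of coordinatewise
-- products factor.
sumᵛ : ∀ {n} → (Vec Bool n → ℕ) → ℕ
sumᵛ {zero}  f = f []
sumᵛ {suc n} f = sumᵛ (f ∘ (false ∷_)) + sumᵛ (f ∘ (true ∷_))

sumᵛ-mono-≤ : ∀ {n} {f g : Vec Bool n → ℕ} → (∀ x → f x ≤ g x) → sumᵛ f ≤ sumᵛ g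
sumᵛ-mono-≤ {zero}  f≤g = f≤g []
sumᵛ-mono-≤ {suc n} f≤g = +-mono-≤ (sumᵛ-mono-≤ (f≤g ∘ (false ∷_))) (sumᵛ-mono-≤ (f≤g ∘ (true ∷_)))

sumᵛ-cong : ∀ {n} {f g : Vec Bool n → ℕ} → f ≗ g → sumᵛ f ≡ sumᵛ g
sumᵛ-cong {zero}  f≗g = f≗g []
sumᵛ-cong {suc n} f≗g = cong₂ _+_ (sumᵛ-cong (f≗g ∘ (false ∷_))) (sumᵛ-cong (f≗g ∘ (true ∷_)))

double : ∀ x c → 2 * x * c ≡ x * c + x * c
double = solve-∀

sumᵛ-const : ∀ n c → sumᵛ {n} (λ _ → c) ≡ 2 ^ n * c
sumᵛ-const zero    c = sym (*-identityˡ c)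
sumᵛ-const (suc n) c = trans (cong₂ _+_ (sumᵛ-const n c) (sumᵛ-const n c)) (sym (double (2 ^ n) c))

sumᵛ-distrib-+ : ∀ {n} (f g : Vec Bool n → ℕ) → sumᵛ (λ x → f x + g x) ≡ sumᵛ f + sumᵛ g
sumᵛ-distrib-+ {zero}  f g = refl
sumᵛ-distrib-+ {suc n} f g =
  trans (cong₂ _+_ (sumᵛ-distrib-+ (f ∘ (false ∷_)) _) (sumᵛ-distrib-+ (f ∘ (true ∷_)) _))
        (eq (sumᵛ (f ∘ (false ∷_))) _ _ _)
  where
  eq : ∀ a b c d → (a + b) + (c + d) ≡ (a + c) + (b + d)
  eq = solve-∀

sumᵛ-distribˡ-* : ∀ {n} c (f : Vec Bool n → ℕ) → sumᵛ (λ x → c * f x) ≡ c * sumᵛ f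
sumᵛ-distribˡ-* {zero}  c f = refl
sumᵛ-distribˡ-* {suc n} c f =
  trans (cong₂ _+_ (sumᵛ-distribˡ-* c (f ∘ (false ∷_))) (sumᵛ-distribˡ-* c (f ∘ (true ∷_))))
        (sym (*-distribˡ-+ c _ _))

sumᵛ-distribʳ-* : ∀ {n} c (f : Vec Bool n → ℕ) → sumᵛ (λ x → f x * c) ≡ sumᵛ f * c
sumᵛ-distribʳ-* c f = trans (sumᵛ-cong (λ x → *-comm (f x) c))
                            (trans (sumᵛ-distribˡ-* c f) (*-comm c _))

sumᵛ-comm : ∀ {m n} (f : Vec Bool m → Vec Bool n → ℕ) →
            sumᵛ (λ x → sumᵛ (f x)) ≡ sumᵛ (λ y → sumᵛ (λ x → f x y))
sumᵛ-comm {zero}  f = refl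
sumᵛ-comm {suc m} f =
  trans (cong₂ _+_ (sumᵛ-comm (f ∘ (false ∷_))) (sumᵛ-comm (f ∘ (true ∷_))))
        (sym (sumᵛ-distrib-+ (λ y → sumᵛ (λ x → f (false ∷ x) y)) _))

f≤sumᵛ : ∀ {n} (f : Vec Bool n → ℕ) x → f x ≤ sumᵛ f
f≤sumᵛ f []          = ≤-refl
f≤sumᵛ f (false ∷ x) = ≤-trans (f≤sumᵛ (f ∘ (false ∷_)) x) (m≤m+n _ _)
f≤sumᵛ f (true ∷ x)  = ≤-trans (f≤sumᵛ (f ∘ (true ∷_)) x) (m≤n+m _ _)

sumᵛ-single : ∀ {n} (f : Vec Bool n → ℕ) x → (∀ y → x ≢ y → f y ≡ 0) → sumᵛ f ≡ f x
sumᵛ-single f []      f≡0 = refl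
sumᵛ-single {suc n} f (b ∷ x) f≡0 = helper b f≡0
  where
  zeros : ∀ (g : Vec Bool n → ℕ) → (∀ y → g y ≡ 0) → sumᵛ g ≡ 0
  zeros g g≡0 = trans (sumᵛ-cong g≡0) (trans (sumᵛ-const n 0) (*-zeroʳ (2 ^ n)))
  helper : ∀ b → (∀ y → b ∷ x ≢ y → f y ≡ 0) → sumᵛ f ≡ f (b ∷ x)
  helper false f≡0 = trans
    (cong₂ _+_ (sumᵛ-single (f ∘ (false ∷_)) x (λ y x≢y → f≡0 _ λ { refl → x≢y refl }))
               (zeros (f ∘ (true ∷_)) (λ y → f≡0 _ λ ())))
    (+-identityʳ _)
  helper true f≡0 =
    cong₂ _+_ (zeros (f ∘ (false ∷_)) (λ y → f≡0 _ λ ()))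
              (sumᵛ-single (f ∘ (true ∷_)) x (λ y x≢y → f≡0 _ λ { refl → x≢y refl }))

-- Of the witnesses for the two halves, the one with the smaller value stays below the overall mean.
-- `extend` uses this in place of a random choice.
sumᵛ-≤-witness : ∀ {n} (f : Vec Bool n → ℕ) → ∃[ x ] 2 ^ n * f x ≤ sumᵛ f
sumᵛ-≤-witness {zero}  f = [] , ≤-reflexive (*-identityˡ _)
sumᵛ-≤-witness {suc n} f with sumᵛ-≤-witness (f ∘ (false ∷_)) | sumᵛ-≤-witness (f ∘ (true ∷_))
... | x , p | y , q with ≤-total (f (false ∷ x)) (f (true ∷ y))
...   | inj₁ r = false ∷ x , ≤-trans (≤-reflexive (double (2 ^ n) _))
                   (+-mono-≤ p (≤-trans (*-monoʳ-≤ (2 ^ n) r) q))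
...   | inj₂ r = true ∷ y , ≤-trans (≤-reflexive (double (2 ^ n) _))
                   (+-mono-≤ (≤-trans (*-monoʳ-≤ (2 ^ n) r) p) q)

sumᶠ-+ : ∀ m n (f : Fin (m + n) → ℕ) → sumᶠ f ≡ sumᶠ (f ∘ (_↑ˡ n)) + sumᶠ (f ∘ (m ↑ʳ_))
sumᶠ-+ zero    n f = refl
sumᶠ-+ (suc m) n f = trans (cong (f zero +_) (sumᶠ-+ m n (f ∘ suc))) (sym (+-assoc (f zero) _ _))


^-distribʳ-* : ∀ p m n → (m * n) ^ p ≡ m ^ p * n ^ p
^-distribʳ-* zero    m n = refl
^-distribʳ-* (suc p) m n = trans (cong (m * n *_) (^-distribʳ-* p m n)) (eq m n (m ^ p) (n ^ p))
  where
  eq : ∀ m n x y → m * n * (x * y) ≡ m * x * (n * y)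
  eq = solve-∀

-- The enumeration splits `2 ^ suc n` as `2 ^ n + (2 ^ n + 0)`, which is how `2 *` unfolds; hence
-- the empty tail on the right.
size≡sumᵛ : ∀ n (D : Vec Bool n → ℕ) → Pebbling.size (hypercube n) D ≡ sumᵛ D
size≡sumᵛ zero    D = +-identityʳ _
size≡sumᵛ (suc n) D = trans (sumᶠ-+ (2 ^ n) (2 ^ n + 0) _) (cong₂ _+_ left right)
  where
  open FiniteGraph (hypercube (suc n)) using (vertex)
  open FiniteGraph (hypercube n) using () renaming (vertex to vertexₙ)
  left : sumᶠ {2 ^ n} (D ∘ vertex ∘ (_↑ˡ (2 ^ n + 0))) ≡ sumᵛ (D ∘ (false ∷_))
  left = trans (sum-cong-≗ {2 ^ n} λ i → cong D (eq i)) (size≡sumᵛ n (D ∘ (false ∷_)))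
    where
    eq : ∀ i → vertex (i ↑ˡ (2 ^ n + 0)) ≡ false ∷ vertexₙ i
    eq i rewrite Fin.splitAt-↑ˡ (2 ^ n) i (2 ^ n + 0) = refl
  right : sumᶠ (D ∘ vertex ∘ (2 ^ n ↑ʳ_)) ≡ sumᵛ (D ∘ (true ∷_))
  right = trans (sumᶠ-+ (2 ^ n) 0 _) (trans (+-identityʳ _)
      (trans (sum-cong-≗ {2 ^ n} λ i → cong D (eq i)) (size≡sumᵛ n (D ∘ (true ∷_)))))
    where
    eq : ∀ i → vertex (2 ^ n ↑ʳ (i ↑ˡ 0)) ≡ true ∷ vertexₙ i
    eq i rewrite Fin.splitAt-↑ʳ (2 ^ n) (2 ^ n + 0) (i ↑ˡ 0)
               | Fin.splitAt-↑ˡ (2 ^ n) i 0 = refl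

-- Weights and their moments

agreement : Bool → Bool → ℕ
agreement false false = 2
agreement false true  = 1
agreement true  false = 1
agreement true  true  = 2

-- 2 ^ (n ∸ d), where d is the distance between the two vertices.
weight : ∀ {n} → Vec Bool n → Vec Bool n → ℕ
weight []      []      = 1
weight (b ∷ x) (c ∷ y) = agreement b c * weight x y

-- The power is a product over coordinates, each contributing `2 ^ p + 1`. The totals needed are
-- `3 ^ n` for `p = 1` and `5 ^ n` for `p = 2`.
sum-weight^ : ∀ {n} p (t : Vec Bool n) → sumᵛ (λ x → weight x t ^ p) ≡ (2 ^ p + 1) ^ n
sum-weight^ {zero} p [] = ^-zeroˡ p
sum-weight^ {suc n} p (c ∷ t) = trans (cong₂ _+_ (half false) (half true)) (both c)
  where
  s = (2 ^ p + 1) ^ n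
  half : ∀ b → sumᵛ (λ x → weight (b ∷ x) (c ∷ t) ^ p) ≡ agreement b c ^ p * s
  half b = trans (sumᵛ-cong (λ x → ^-distribʳ-* p (agreement b c) (weight x t)))
    (trans (sumᵛ-distribˡ-* (agreement b c ^ p) (λ x → weight x t ^ p))
           (cong (agreement b c ^ p *_) (sum-weight^ p t)))
  both : ∀ c → agreement false c ^ p * s + agreement true c ^ p * s ≡ (2 ^ p + 1) * s
  both false rewrite ^-zeroˡ p = sym (*-distribʳ-+ s (2 ^ p) 1)
  both true  rewrite ^-zeroˡ p = trans (+-comm (1 * s) (2 ^ p * s)) (sym (*-distribʳ-+ s (2 ^ p) 1))

weight-comm : ∀ {n} (x y : Vec Bool n) → weight x y ≡ weight y x
weight-comm []      []      = refl
weight-comm (b ∷ x) (c ∷ y) = cong₂ _*_ (comm b c) (weight-comm x y)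
  where
  comm : ∀ b c → agreement b c ≡ agreement c b
  comm false false = refl
  comm false true  = refl
  comm true  false = refl
  comm true  true  = refl

weight-refl : ∀ {n} (x : Vec Bool n) → weight x x ≡ 2 ^ n
weight-refl []          = refl
weight-refl (false ∷ x) = cong (2 *_) (weight-refl x)
weight-refl (true ∷ x)  = cong (2 *_) (weight-refl x)

agreement≥1 : ∀ b c → 1 ≤ agreement b c
agreement≥1 false false = s≤s z≤n
agreement≥1 false true  = s≤s z≤n
agreement≥1 true  false = s≤s z≤n
agreement≥1 true  true  = s≤s z≤n

agreement≤2 : ∀ b c → agreement b c ≤ 2
agreement≤2 false false = ≤-refl
agreement≤2 false true  = s≤s z≤n
agreement≤2 true  false = s≤s z≤n
agreement≤2 true  true  = ≤-refl

weight≥1 : ∀ {n} (x y : Vec Bool n) → 1 ≤ weight x y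
weight≥1 []      []      = ≤-refl
weight≥1 (b ∷ x) (c ∷ y) = *-mono-≤ (agreement≥1 b c) (weight≥1 x y)

weight≤2^n : ∀ {n} (x y : Vec Bool n) → weight x y ≤ 2 ^ n
weight≤2^n []      []      = ≤-refl
weight≤2^n (b ∷ x) (c ∷ y) = *-mono-≤ (agreement≤2 b c) (weight≤2^n x y)

-- Adjacency by recursion on coordinates

data Adjacent : ∀ {n} → Vec Bool n → Vec Bool n → Set where
  here  : ∀ {n b c} {x : Vec Bool n} → b ≢ c → Adjacent (b ∷ x) (c ∷ x)
  there : ∀ {n b} {x y : Vec Bool n} → Adjacent x y → Adjacent (b ∷ x) (b ∷ y)

lookup-injective : ∀ {n} {x y : Vec Bool n} → (∀ i → lookup x i ≡ lookup y i) → x ≡ y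
lookup-injective {x = []}    {[]}    eq = refl
lookup-injective {x = b ∷ x} {c ∷ y} eq = cong₂ _∷_ (eq zero) (lookup-injective (eq ∘ suc))

-- Uniqueness rules out a difference at any other coordinate, and equality of Booleans is stable
-- under double negation.
DifferInExactlyOne⇒Adjacent : ∀ {n} {x y : Vec Bool n} → DifferInExactlyOne x y → Adjacent x y
DifferInExactlyOne⇒Adjacent {x = b ∷ x} {c ∷ y} (zero , b≢c , unique)
  with refl ← lookup-injective {x = x} {y} (λ i → decidable-stable (lookup x i Bool.≟ lookup y i)
                (λ ne → Fin.0≢1+n (unique {suc i} ne))) = here b≢c
DifferInExactlyOne⇒Adjacent {x = b ∷ x} {c ∷ y} (suc i , x≢y , unique)
  with refl ← decidable-stable (b Bool.≟ c) (λ ne → Fin.0≢1+n (sym (unique {zero} ne))) =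
  there (DifferInExactlyOne⇒Adjacent (i , x≢y , λ {j} ne → Fin.suc-injective (unique {suc j} ne)))

Adjacent⇒DifferInExactlyOne : ∀ {n} {x y : Vec Bool n} → Adjacent x y → DifferInExactlyOne x y
Adjacent⇒DifferInExactlyOne {x = b ∷ x} {c ∷ _} (here b≢c) = zero , b≢c , unique
  where
  unique : ∀ {j} → lookup (b ∷ x) j ≢ lookup (c ∷ x) j → zero ≡ j
  unique {zero}  _  = refl
  unique {suc j} ne = contradiction refl ne
Adjacent⇒DifferInExactlyOne {x = b ∷ x} {_ ∷ y} (there a)
  with i , x≢y , u ← Adjacent⇒DifferInExactlyOne a = suc i , x≢y , unique
  where
  unique : ∀ {j} → lookup (b ∷ x) j ≢ lookup (b ∷ y) j → suc i ≡ j
  unique {zero}  ne = contradiction refl ne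
  unique {suc j} ne = cong suc (u ne)

-- Only the factor at the changed coordinate differs, and it is 1 or 2. So a move trades two pebbles
-- for one of no greater weight.
weight-adjacent : ∀ {n} {x y : Vec Bool n} → Adjacent x y → ∀ t → weight y t ≤ 2 * weight x t
weight-adjacent {suc n} {b ∷ x} {c ∷ _} (here _) (d ∷ t) =
  ≤-trans (*-monoˡ-≤ (weight x t) (≤-trans (agreement≤2 c d) (*-monoʳ-≤ 2 (agreement≥1 b d))))
          (≤-reflexive (*-assoc 2 (agreement b d) _))
weight-adjacent {x = b ∷ x} {_ ∷ y} (there a) (d ∷ t) =
  ≤-trans (*-monoʳ-≤ (agreement b d) (weight-adjacent a t))
          (≤-reflexive (eq (agreement b d) (weight x t)))
  where
  eq : ∀ a w → a * (2 * w) ≡ 2 * (a * w)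
  eq = solve-∀

-- Lower bound by total weight

module _ {n : ℕ} where
  open Pebbling (hypercube n)
  open FiniteGraph (hypercube n) using (_~_)

  totalWeight : Distribution → Vec Bool n → ℕ
  totalWeight D t = sumᵛ (λ v → D v * weight v t)

  sumᵛ-δ : ∀ u (f : Vec Bool n → ℕ) → sumᵛ (λ w → δ u w * f w) ≡ f u
  sumᵛ-δ u f = trans (sumᵛ-single (λ w → δ u w * f w) u (λ w u≢w → cong (_* f w) (δ-diff u≢w)))
                     (trans (cong (_* f u) (δ-same u)) (*-identityˡ (f u)))

  totalWeight-move : ∀ {u v} D → u ~ v → 2 ≤ D u → ∀ t →
                     totalWeight (moveAlong u v D) t ≤ totalWeight D t
  totalWeight-move {u} {v} D u~v 2≤Du t = begin
    sumᵛ (λ w → ((D w ∸ 2 * δ u w) + δ v w) * K w)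
      ≡⟨ sumᵛ-cong (λ w → *-distribʳ-+ (K w) (D w ∸ 2 * δ u w) (δ v w)) ⟩
    sumᵛ (λ w → (D w ∸ 2 * δ u w) * K w + δ v w * K w)
      ≡⟨ sumᵛ-distrib-+ (λ w → (D w ∸ 2 * δ u w) * K w) (λ w → δ v w * K w) ⟩
    rest + sumᵛ (λ w → δ v w * K w)
      ≡⟨ cong (rest +_) (sumᵛ-δ v K) ⟩
    rest + K v
      ≤⟨ +-monoʳ-≤ rest (weight-adjacent (DifferInExactlyOne⇒Adjacent {x = u} {v} u~v) t) ⟩
    rest + 2 * K u
      ≡⟨ cong (λ s → rest + 2 * s) (sym (sumᵛ-δ u K)) ⟩
    rest + 2 * sumᵛ (λ w → δ u w * K w)
      ≡⟨ cong (rest +_) (sym (sumᵛ-distribˡ-* 2 (λ w → δ u w * K w))) ⟩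
    rest + sumᵛ (λ w → 2 * (δ u w * K w))
      ≡⟨ sym (sumᵛ-distrib-+ (λ w → (D w ∸ 2 * δ u w) * K w) (λ w → 2 * (δ u w * K w))) ⟩
    sumᵛ (λ w → (D w ∸ 2 * δ u w) * K w + 2 * (δ u w * K w))
      -- The truncated subtraction is exact, since `u` holds at least two pebbles.
      ≡⟨ sumᵛ-cong (λ w → trans (eq (D w ∸ 2 * δ u w) (δ u w) (K w))
                                (cong (_* K w) (m∸n+n≡m (2δ≤ {D} 2≤Du w)))) ⟩
    sumᵛ (λ w → D w * K w) ∎
    where
    open ≤-Reasoning
    K = λ w → weight w t
    rest = sumᵛ (λ w → (D w ∸ 2 * δ u w) * K w)
    eq : ∀ a d k → a * k + 2 * (d * k) ≡ (a + 2 * d) * k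
    eq = solve-∀

  reachable⇒2^n≤totalWeight : ∀ {D D′ t} → Star _⟶_ D D′ → 1 ≤ D′ t → 2 ^ n ≤ totalWeight D t
  reachable⇒2^n≤totalWeight {D} {t = t} ε 1≤ = begin
    2 ^ n                ≡⟨ sym (weight-refl t) ⟩
    weight t t           ≤⟨ m≤n*m (weight t t) (D t) {{>-nonZero 1≤}} ⟩
    D t * weight t t     ≤⟨ f≤sumᵛ (λ v → D v * weight v t) t ⟩
    totalWeight D t      ∎
    where open ≤-Reasoning
  reachable⇒2^n≤totalWeight {D} {t = t} (move u~v 2≤ ◅ ms) 1≤ =
    ≤-trans (reachable⇒2^n≤totalWeight ms 1≤) (totalWeight-move D u~v 2≤ t)

  -- Double counting: over all targets together a pebble weighs `3 ^ n`, wherever it lies, while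
  -- each target demands `2 ^ n`.
  solvable⇒4^n≤size*3^n : ∀ D → Solvable D → 4 ^ n ≤ size D * 3 ^ n
  solvable⇒4^n≤size*3^n D solv = begin
    4 ^ n                                      ≡⟨ ^-distribʳ-* n 2 2 ⟩
    2 ^ n * 2 ^ n                              ≡⟨ sym (sumᵛ-const n (2 ^ n)) ⟩
    sumᵛ {n} (λ _ → 2 ^ n)                     ≤⟨ sumᵛ-mono-≤ {n} (λ t → let _ , ms , 1≤ = solv t in
                                                    reachable⇒2^n≤totalWeight ms 1≤) ⟩
    sumᵛ (λ t → sumᵛ (λ v → D v * weight v t)) ≡⟨ sumᵛ-comm (λ t v → D v * weight v t) ⟩
    sumᵛ (λ v → sumᵛ (λ t → D v * weight v t)) ≡⟨ sumᵛ-cong (λ v → sumᵛ-distribˡ-* (D v) (weight v)) ⟩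
    sumᵛ (λ v → D v * sumᵛ (weight v))         ≡⟨ sumᵛ-cong (λ v → cong (D v *_) (sum-weight v)) ⟩
    sumᵛ (λ v → D v * 3 ^ n)                   ≡⟨ sumᵛ-distribʳ-* (3 ^ n) D ⟩
    sumᵛ D * 3 ^ n                             ≡⟨ cong (_* 3 ^ n) (sym (size≡sumᵛ n D)) ⟩
    size D * 3 ^ n                             ∎
    where
    open ≤-Reasoning
    sum-weight : ∀ v → sumᵛ (weight v) ≡ 3 ^ n
    sum-weight v = trans (sumᵛ-cong (λ t → trans (weight-comm v t) (sym (^-identityʳ (weight t v)))))
                         (sum-weight^ 1 v)

-- Moves on lists of pebbles

-- A list of vertices stands for the distribution with one pebble per entry.
infix 4 _⇝_
infixr 5 _++⇝_

data _⇝_ {n} : List (Vec Bool n) → List (Vec Bool n) → Set where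
  move⇝   : ∀ {u v} → Adjacent u v → u ∷ u ∷ [] ⇝ v ∷ []
  drop⇝   : ∀ {us} → us ⇝ []
  refl⇝   : ∀ {us} → us ⇝ us
  trans⇝  : ∀ {us vs ws} → us ⇝ vs → vs ⇝ ws → us ⇝ ws
  _++⇝_   : ∀ {us us′ vs vs′} → us ⇝ us′ → vs ⇝ vs′ → us ++ vs ⇝ us′ ++ vs′

module _ {n : ℕ} where
  open Pebbling (hypercube n)

  ⟦_⟧ : List (Vec Bool n) → Distribution
  ⟦ us ⟧ w = sum (map (λ u → δ u w) us)

  ⟦⟧-++ : ∀ us vs w → ⟦ us ++ vs ⟧ w ≡ ⟦ us ⟧ w + ⟦ vs ⟧ w
  ⟦⟧-++ []       vs w = refl
  ⟦⟧-++ (u ∷ us) vs w = trans (cong (δ u w +_) (⟦⟧-++ us vs w)) (sym (+-assoc (δ u w) _ _))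

  size-⟦⟧ : ∀ us → size ⟦ us ⟧ ≡ length us
  size-⟦⟧ []       = sum-replicate-zero (2 ^ n)
  size-⟦⟧ (u ∷ us) = trans (∑-distrib-+ (δ u ∘ vertex) (⟦ us ⟧ ∘ vertex))
                           (cong₂ _+_ (size-δ u) (size-⟦⟧ us))
    where open FiniteGraph (hypercube n) using (vertex)

  -- `F` is a frame of pebbles left in place: in `us ++ vs`, each half moves with the other half in
  -- its frame. Domination replaces equality, so that `drop⇝` takes no move.
  ⇝-sound : ∀ {us vs} → us ⇝ vs → ∀ F G → (∀ w → ⟦ us ⟧ w + F w ≤ G w) →
            ∃[ G′ ] Star _⟶_ G G′ × (∀ w → ⟦ vs ⟧ w + F w ≤ G′ w)
  ⇝-sound (move⇝ {u} {v} u~v) F G ≤G =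
    moveAlong u v G , move (Adjacent⇒DifferInExactlyOne u~v) 2≤Gu ◅ ε , ≤G′
    where
    open ≤-Reasoning
    2≤Gu : 2 ≤ G u
    2≤Gu = ≤-trans (≤-trans (≤-reflexive (sym (cong (λ d → d + (d + 0)) (δ-same u)))) (m≤m+n _ (F u))) (≤G u)
    ≤G′ : ∀ w → δ v w + 0 + F w ≤ (G w ∸ 2 * δ u w) + δ v w
    ≤G′ w = begin
      δ v w + 0 + F w                            ≡⟨ cong (_+ F w) (+-identityʳ (δ v w)) ⟩
      δ v w + F w                                ≡⟨ +-comm (δ v w) (F w) ⟩
      F w + δ v w                                ≡⟨ cong (_+ δ v w) (sym (m+n∸m≡n (2 * δ u w) (F w))) ⟩
      (2 * δ u w + F w ∸ 2 * δ u w) + δ v w      ≤⟨ +-monoˡ-≤ (δ v w) (∸-monoˡ-≤ (2 * δ u w) (≤G w)) ⟩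
      (G w ∸ 2 * δ u w) + δ v w                  ∎
  ⇝-sound (drop⇝ {us}) F G ≤G = G , ε , λ w → ≤-trans (m≤n+m (F w) (⟦ us ⟧ w)) (≤G w)
  ⇝-sound refl⇝ F G ≤G = G , ε , ≤G
  ⇝-sound (trans⇝ p q) F G ≤G
    with G₁ , ms₁ , ≤G₁ ← ⇝-sound p F G ≤G
    with G₂ , ms₂ , ≤G₂ ← ⇝-sound q F G₁ ≤G₁ = G₂ , ms₁ ◅◅ ms₂ , ≤G₂
  ⇝-sound (_++⇝_ {us} {us′} {vs} {vs′} p q) F G ≤G
    with G₁ , ms₁ , ≤G₁ ← ⇝-sound p (λ w → ⟦ vs ⟧ w + F w) G
           (λ w → ≤-trans (≤-reflexive (trans (sym (+-assoc (⟦ us ⟧ w) _ _))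
                                              (cong (_+ F w) (sym (⟦⟧-++ us vs w))))) (≤G w))
    with G₂ , ms₂ , ≤G₂ ← ⇝-sound q (λ w → ⟦ us′ ⟧ w + F w) G₁
           (λ w → ≤-trans (≤-reflexive (x∙yz≈y∙xz (⟦ vs ⟧ w) (⟦ us′ ⟧ w) (F w))) (≤G₁ w)) =
    G₂ , ms₁ ◅◅ ms₂ , λ w → ≤-trans (≤-reflexive (trans (cong (_+ F w) (⟦⟧-++ us′ vs′ w))
                                                      (xy∙z≈y∙xz (⟦ us′ ⟧ w) (⟦ vs′ ⟧ w) (F w)))) (≤G₂ w)

  ⇝⇒Reachable : ∀ {us t} → us ⇝ t ∷ [] → Reachable ⟦ us ⟧ t
  ⇝⇒Reachable {us} {t} p with G , ms , ≤G ← ⇝-sound p (λ _ → 0) ⟦ us ⟧ (λ w → ≤-reflexive (+-identityʳ _)) =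
    G , ms , ≤-trans (≤-reflexive (sym (cong (λ d → d + 0 + 0) (δ-same t)))) (≤G t)

map⇝ : ∀ {m n} (f : Vec Bool m → Vec Bool n) → (∀ {u v} → Adjacent u v → Adjacent (f u) (f v)) →
       ∀ {us vs} → us ⇝ vs → map f us ⇝ map f vs
map⇝ f adj (move⇝ a)    = move⇝ (adj a)
map⇝ f adj drop⇝        = drop⇝
map⇝ f adj refl⇝        = refl⇝
map⇝ f adj (trans⇝ p q) = trans⇝ (map⇝ f adj p) (map⇝ f adj q)
map⇝ f adj (_++⇝_ {us} {us′} {vs} {vs′} p q)
  rewrite map-++ f us vs | map-++ f us′ vs′ = map⇝ f adj p ++⇝ map⇝ f adj q

++-adjacentʳ : ∀ {m n} (x : Vec Bool m) {u v : Vec Bool n} → Adjacent u v → Adjacent (x Vec.++ u) (x Vec.++ v)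
++-adjacentʳ []      a = a
++-adjacentʳ (b ∷ x) a = there (++-adjacentʳ x a)

++-adjacentˡ : ∀ {m n} (y : Vec Bool n) {u v : Vec Bool m} → Adjacent u v → Adjacent (u Vec.++ y) (v Vec.++ y)
++-adjacentˡ y (here b≢c) = here b≢c
++-adjacentˡ y (there a)  = there (++-adjacentˡ y a)

replicate-+ : ∀ {A : Set} m n (x : A) → replicate (m + n) x ≡ replicate m x ++ replicate n x
replicate-+ zero    n x = refl
replicate-+ (suc m) n x = cong (x ∷_) (replicate-+ m n x)

replicate-move : ∀ {n} k {u v : Vec Bool n} → Adjacent u v → replicate (k * 2) u ⇝ replicate k v
replicate-move zero    a = refl⇝
replicate-move (suc k) a = move⇝ a ++⇝ replicate-move k a

replicate-mono : ∀ {n} {j k} (u : Vec Bool n) → j ≤ k → replicate k u ⇝ replicate j u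
replicate-mono u z≤n       = drop⇝
replicate-mono u (s≤s j≤k) = refl⇝ {us = u ∷ []} ++⇝ replicate-mono u j≤k

-- Both halves of the pile first travel from `y` to `t` without changing the first coordinate. If it
-- has to change, the two resulting piles of `weight y t` then cross in pairs, so no pebble is left
-- over.
replicate-weight : ∀ {n} (y t : Vec Bool n) → replicate (2 ^ n) y ⇝ replicate (weight y t) t
replicate-weight [] [] = refl⇝
replicate-weight {suc n} (b ∷ y) (c ∷ t) = helper b c
  where
  one : ∀ b → replicate (2 ^ n) (b ∷ y) ⇝ replicate (weight y t) (b ∷ t)
  one b = subst₂ _⇝_ (map-replicate (b ∷_) (2 ^ n) y) (map-replicate (b ∷_) (weight y t) t)
                 (map⇝ (b ∷_) there (replicate-weight y t))
  two : ∀ b → replicate (2 * 2 ^ n) (b ∷ y) ⇝ replicate (2 * weight y t) (b ∷ t)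
  two b = subst₂ _⇝_ (eq (2 ^ n) (b ∷ y)) (eq (weight y t) (b ∷ t)) (one b ++⇝ one b)
    where
    eq : ∀ k (u : Vec Bool (suc n)) → replicate k u ++ replicate k u ≡ replicate (2 * k) u
    eq k u = trans (sym (replicate-+ k k u)) (cong (λ j → replicate (k + j) u) (sym (+-identityʳ k)))
  flip : ∀ {b c} → b ≢ c → replicate (2 * 2 ^ n) (b ∷ y) ⇝ replicate (1 * weight y t) (c ∷ t)
  flip {b} {c} b≢c = trans⇝ (two b) (subst₂ _⇝_ (cong (λ j → replicate j (b ∷ t)) (*-comm (weight y t) 2))
    (cong (λ j → replicate j (c ∷ t)) (sym (*-identityˡ (weight y t)))) (replicate-move (weight y t) (here b≢c)))
  helper : ∀ b c → replicate (2 * 2 ^ n) (b ∷ y) ⇝ replicate (agreement b c * weight y t) (c ∷ t)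
  helper false false = two false
  helper false true  = flip λ ()
  helper true  false = flip λ ()
  helper true  true  = two true

-- Multiples and products of lists

module _ {A : Set} where
  scale : ℕ → List A → List A
  scale k = concatMap (replicate k)

  length-scale : ∀ k us → length (scale k us) ≡ length us * k
  length-scale k []       = refl
  length-scale k (u ∷ us) = trans (length-++ (replicate k u)) (cong₂ _+_ (length-replicate k) (length-scale k us))

  scale-replicate : ∀ j k (u : A) → scale j (replicate k u) ≡ replicate (k * j) u
  scale-replicate j zero    u = refl
  scale-replicate j (suc k) u = trans (cong (replicate j u ++_) (scale-replicate j k u)) (sym (replicate-+ j (k * j) u))

  scale-++ : ∀ k (us vs : List A) → scale k (us ++ vs) ≡ scale k us ++ scale k vs
  scale-++ k = concatMap-++ (replicate k)

  scale-scale : ∀ j k us → scale j (scale k us) ≡ scale (k * j) us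
  scale-scale j k []       = refl
  scale-scale j k (u ∷ us) = trans (scale-++ j (replicate k u) (scale k us))
                                   (cong₂ _++_ (scale-replicate j k u) (scale-scale j k us))

scale-map : ∀ {A B : Set} k (f : A → B) us → scale k (map f us) ≡ map f (scale k us)
scale-map k f []       = refl
scale-map k f (u ∷ us) = trans (cong₂ _++_ (sym (map-replicate f k u)) (scale-map k f us))
                               (sym (map-++ f (replicate k u) (scale k us)))

scale⇝ : ∀ {n} k (us : List (Vec Bool n)) → 1 ≤ k → scale k us ⇝ us
scale⇝ k []       1≤k = refl⇝
scale⇝ k (u ∷ us) 1≤k = replicate-mono {j = 1} u 1≤k ++⇝ scale⇝ k us 1≤k

-- The multiplicity is kept apart from the list because the product construction trades one
-- multiplicity for another.
Solving : ∀ {n} → ℕ → List (Vec Bool n) → Set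
Solving L S = ∀ t → scale L S ⇝ t ∷ []

received : ∀ {n} → List (Vec Bool n) → Vec Bool n → ℕ
received E t = sum (map (λ y → weight y t) E)

scale⇝received : ∀ {n} (E : List (Vec Bool n)) t → scale (2 ^ n) E ⇝ replicate (received E t) t
scale⇝received []      t = refl⇝
scale⇝received (y ∷ E) t = subst (_ ⇝_) (sym (replicate-+ (weight y t) (received E t) t))
                                        (replicate-weight y t ++⇝ scale⇝received E t)

infixr 5 _⊗_
_⊗_ : ∀ {m n} → List (Vec Bool m) → List (Vec Bool n) → List (Vec Bool (m + n))
E ⊗ S = concatMap (λ s → map (Vec._++ s) E) S

length-⊗ : ∀ {m n} (E : List (Vec Bool m)) (S : List (Vec Bool n)) → length (E ⊗ S) ≡ length S * length E
length-⊗ E []      = refl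
length-⊗ E (s ∷ S) = trans (length-++ (map (Vec._++ s) E)) (cong₂ _+_ (length-map (Vec._++ s) E) (length-⊗ E S))

-- Moves within the fibres come first and gather `M` pebbles over `t` for every entry of `S`. The
-- slice over `t` then carries `M` copies of `S`.
⊗-solving : ∀ {m n L M} (E : List (Vec Bool m)) (S : List (Vec Bool n)) →
            (∀ t → scale L E ⇝ replicate M t) → Solving M S → Solving L (E ⊗ S)
⊗-solving {m} {n} {L} {M} E S stack solve ts with Vec.splitAt m ts
... | t , s , refl = trans⇝ (fibres S) (map⇝ (t Vec.++_) (++-adjacentʳ t) (solve s))
  where
  fibre : ∀ s → scale L (map (Vec._++ s) E) ⇝ map (t Vec.++_) (replicate M s)
  fibre s = subst₂ _⇝_ (sym (scale-map L (Vec._++ s) E))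
    (trans (map-replicate (Vec._++ s) M t) (sym (map-replicate (t Vec.++_) M s)))
    (map⇝ (Vec._++ s) (++-adjacentˡ s) (stack t))
  fibres : ∀ S → scale L (E ⊗ S) ⇝ map (t Vec.++_) (scale M S)
  fibres []      = refl⇝
  fibres (s ∷ S) = subst₂ _⇝_ (sym (scale-++ L (map (Vec._++ s) E) (E ⊗ S)))
    (sym (map-++ (t Vec.++_) (replicate M s) (scale M S)))
    (fibre s ++⇝ fibres S)

-- Powers of 1 - 1/q

-- (1 − 1/q)^k ≤ 1/(1 + k/q), where q = p + 1.
pow-≤-inverse : ∀ p k → p ^ k * (suc p + k) ≤ suc p * suc p ^ k
pow-≤-inverse p zero    = ≤-reflexive (eq (suc p))
  where
  eq : ∀ q → 1 * (q + 0) ≡ q * 1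
  eq = solve-∀
pow-≤-inverse p (suc k) = begin
  p * p ^ k * (suc p + suc k)        ≡⟨ eq₁ p k (p ^ k) ⟩
  p ^ k * (p * suc p + (p * k + p))  ≤⟨ *-monoʳ-≤ (p ^ k) (m≤m+n _ (suc k)) ⟩
  p ^ k * (p * suc p + (p * k + p) + suc k) ≡⟨ eq₂ p k (p ^ k) ⟩
  suc p * (p ^ k * (suc p + k))      ≤⟨ *-monoʳ-≤ (suc p) (pow-≤-inverse p k) ⟩
  suc p * (suc p * suc p ^ k)        ∎
  where
  open ≤-Reasoning
  eq₁ : ∀ p k x → p * x * (suc p + suc k) ≡ x * (p * suc p + (p * k + p))
  eq₁ = solve-∀
  eq₂ : ∀ p k x → x * (p * suc p + (p * k + p) + suc k) ≡ suc p * (x * (suc p + k))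
  eq₂ = solve-∀

-- (1 − 1/q)^k ≤ 1 − k/q + (k/q)².
pow-≤-quadratic : ∀ p k → let q = suc p in
                  q * q * p ^ k + q * k * q ^ k ≤ q ^ k * (q * q + k * k)
pow-≤-quadratic p k = *-cancelʳ-≤ _ _ (q + k) (begin
  (q * q * p ^ k + q * k * q ^ k) * (q + k)              ≡⟨ eq₁ q k (p ^ k) (q ^ k) ⟩
  q * q * (p ^ k * (q + k)) + q * k * q ^ k * (q + k)    ≤⟨ +-monoˡ-≤ (q * k * q ^ k * (q + k)) (*-monoʳ-≤ (q * q) (pow-≤-inverse p k)) ⟩
  -- For `x = k/q`, `(1 + x)(1 − x + x²) = 1 + x³`; the summand added here is the cube.
  q * q * (q * q ^ k) + q * k * q ^ k * (q + k)          ≤⟨ m≤m+n _ (k * k * k * q ^ k) ⟩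
  q * q * (q * q ^ k) + q * k * q ^ k * (q + k) + k * k * k * q ^ k ≡⟨ eq₂ q k (q ^ k) ⟩
  q ^ k * (q * q + k * k) * (q + k)                      ∎)
  where
  open ≤-Reasoning
  q = suc p
  eq₁ : ∀ q k x y → (q * q * x + q * k * y) * (q + k) ≡ q * q * (x * (q + k)) + q * k * y * (q + k)
  eq₁ = solve-∀
  eq₂ : ∀ q k y → q * q * (q * y) + q * k * y * (q + k) + k * k * k * y ≡ y * (q * q + k * k) * (q + k)
  eq₂ = solve-∀

-- Bernoulli's inequality `(1 − 1/q)^r ≥ 1 − r/q`, cleared of denominators.
bernoulli : ∀ p r → let q = suc p in q * q ^ r ≤ q * p ^ r + r * q ^ r
bernoulli p zero    = ≤-reflexive (sym (+-identityʳ _))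
bernoulli p (suc r) = begin
  q * (q * q ^ r)                          ≤⟨ *-monoʳ-≤ q (bernoulli p r) ⟩
  q * (q * p ^ r + r * q ^ r)              ≡⟨ eq₁ p r (p ^ r) (q ^ r) ⟩
  q * (p * p ^ r) + q * p ^ r + q * (r * q ^ r) ≤⟨ +-monoˡ-≤ (q * (r * q ^ r)) (+-monoʳ-≤ (q * (p * p ^ r)) (*-monoʳ-≤ q (^-monoˡ-≤ r (n≤1+n p)))) ⟩
  q * (p * p ^ r) + q * q ^ r + q * (r * q ^ r) ≡⟨ eq₂ p r (p ^ r) (q ^ r) ⟩
  q * (p * p ^ r) + suc r * (q * q ^ r)    ∎
  where
  open ≤-Reasoning
  q = suc p
  eq₁ : ∀ p r x y → suc p * (suc p * x + r * y) ≡ suc p * (p * x) + suc p * x + suc p * (r * y)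
  eq₁ = solve-∀
  eq₂ : ∀ p r x y → suc p * (p * x) + suc p * y + suc p * (r * y) ≡ suc p * (p * x) + suc r * (suc p * y)
  eq₂ = solve-∀

-- (1 − 1/q)^q ≤ 1/2.
2*p^q≤q^q : ∀ p → 2 * p ^ suc p ≤ suc p ^ suc p
2*p^q≤q^q p = *-cancelˡ-≤ q (≤-trans (≤-reflexive (eq q (p ^ q))) (pow-≤-inverse p q))
  where
  q = suc p
  eq : ∀ q x → q * (2 * x) ≡ x * (q + q)
  eq = solve-∀

-- Composes `s′ ≤ (c/a) s` with `s ≤ (C/A) x` without division, as iterating `extend` requires.
chain-≤ : ∀ a A c C x {s s′} → a * s′ ≤ c * s → A * s ≤ C * x → a * A * s′ ≤ c * C * x
chain-≤ a A c C x {s} {s′} as′≤cs As≤Cx = begin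
  a * A * s′    ≡⟨ eq₁ a A s′ ⟩
  A * (a * s′)  ≤⟨ *-monoʳ-≤ A as′≤cs ⟩
  A * (c * s)   ≡⟨ eq₂ A c s ⟩
  c * (A * s)   ≤⟨ *-monoʳ-≤ c As≤Cx ⟩
  c * (C * x)   ≡⟨ sym (*-assoc c C x) ⟩
  c * C * x     ∎
  where
  open ≤-Reasoning
  eq₁ : ∀ a A s → a * A * s ≡ A * (a * s)
  eq₁ = solve-∀
  eq₂ : ∀ A c s → A * (c * s) ≡ c * (A * s)
  eq₂ = solve-∀

-- Greedy choice of the points of a block

-- The derandomised Chernoff bound: the points of E are chosen one by one so
-- that the sum over t of β ^ received E t is at most its mean for random
-- points, where β = 1 − 1/q.  Powers of q clear the denominators.
module Greedy (n p r : ℕ) .{{_ : NonZero p}}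
              -- Divided by `2 ^ n * q`: `r` is at most the mean weight `(3/2) ^ n` less `1/q` times
              -- the mean squared weight `(5/2) ^ n`.
              (few : 2 ^ n * r * suc p + 5 ^ n ≤ 3 ^ n * suc p) where
  q X : ℕ
  q = suc p
  X = 2 ^ n

  -- `β ^ weight y t` multiplied by `q ^ X`, which is an integer because weights are at most `X`.
  factor : Vec Bool n → Vec Bool n → ℕ
  factor y t = p ^ weight y t * q ^ (X ∸ weight y t)

  q^k*q^[X∸k] : ∀ (y t : Vec Bool n) → q ^ weight y t * q ^ (X ∸ weight y t) ≡ q ^ X
  q^k*q^[X∸k] y t = trans (sym (^-distribˡ-+-* q (weight y t) _))
                          (cong (q ^_) (m+[n∸m]≡n (weight≤2^n y t)))

  factor-≤ : ∀ y t → q * q * factor y t + q * q ^ X * weight y t ≤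
                     q ^ X * (q * q) + q ^ X * weight y t ^ 2
  factor-≤ y t = begin
    q * q * (p ^ k * z) + q * q ^ X * k          ≡⟨ cong (λ s → q * q * (p ^ k * z) + q * s * k) (sym (q^k*q^[X∸k] y t)) ⟩
    q * q * (p ^ k * z) + q * (q ^ k * z) * k    ≡⟨ eq₁ q (p ^ k) z (q ^ k) k ⟩
    (q * q * p ^ k + q * k * q ^ k) * z          ≤⟨ *-monoˡ-≤ z (pow-≤-quadratic p k) ⟩
    q ^ k * (q * q + k * k) * z                  ≡⟨ eq₂ q z (q ^ k) k ⟩
    q ^ k * z * (q * q) + q ^ k * z * (k * (k * 1))  ≡⟨ cong (λ s → s * (q * q) + s * k ^ 2) (q^k*q^[X∸k] y t) ⟩
    q ^ X * (q * q) + q ^ X * k ^ 2              ∎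
    where
    open ≤-Reasoning
    k = weight y t
    z = q ^ (X ∸ k)
    eq₁ : ∀ q x z y k → q * q * (x * z) + q * (y * z) * k ≡ (q * q * x + q * k * y) * z
    eq₁ = solve-∀
    eq₂ : ∀ q z y k → y * (q * q + k * k) * z ≡ y * z * (q * q) + y * z * (k * (k * 1))
    eq₂ = solve-∀

  -- Averaging the quadratic bound over `y` by the first two moments gives at most `1 − r/q`, thanks
  -- to `few`, and Bernoulli's inequality bounds that by `β ^ r`.
  sum-factor-≤ : ∀ t → q ^ r * sumᵛ (λ y → factor y t) ≤ X * (p ^ r * q ^ X)
  sum-factor-≤ t = *-cancelˡ-≤ (q * q) (+-cancelʳ-≤ (q ^ r * (q ^ X * (X * r * q))) _ _ (begin
    q * q * (q ^ r * s) + q ^ r * (q ^ X * (X * r * q)) ≡⟨ eq₁ q (q ^ r) s (q ^ X * (X * r * q)) ⟩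
    q ^ r * (q * q * s + q ^ X * (X * r * q))           ≤⟨ *-monoʳ-≤ (q ^ r) bound ⟩
    q ^ r * (q ^ X * (q * q) * X)                       ≡⟨ eq₂ q (q ^ r) (q ^ X) X ⟩
    X * (q ^ X * (q * (q * q ^ r)))                     ≤⟨ *-monoʳ-≤ X (*-monoʳ-≤ (q ^ X) (*-monoʳ-≤ q (bernoulli p r))) ⟩
    X * (q ^ X * (q * (q * p ^ r + r * q ^ r)))         ≡⟨ eq₃ q (q ^ r) (p ^ r) (q ^ X) X r ⟩
    q * q * (X * (p ^ r * q ^ X)) + q ^ r * (q ^ X * (X * r * q)) ∎))
    where
    open ≤-Reasoning
    s = sumᵛ (λ y → factor y t)
    eq₁ : ∀ q x s z → q * q * (x * s) + x * z ≡ x * (q * q * s + z)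
    eq₁ = solve-∀
    eq₂ : ∀ q x y X → x * (y * (q * q) * X) ≡ X * (y * (q * (q * x)))
    eq₂ = solve-∀
    eq₃ : ∀ q x z y X r → X * (y * (q * (q * z + r * x))) ≡ q * q * (X * (z * y)) + x * (y * (X * r * q))
    eq₃ = solve-∀
    moments : q * q * s + q * q ^ X * 3 ^ n ≤ q ^ X * (q * q) * X + q ^ X * 5 ^ n
    moments = begin
      q * q * s + q * q ^ X * 3 ^ n
        ≡⟨ cong₂ (λ a b → a + q * q ^ X * b) (sym (sumᵛ-distribˡ-* (q * q) (λ y → factor y t)))
             (trans (sym (sum-weight^ 1 t)) (sumᵛ-cong (λ y → ^-identityʳ (weight y t)))) ⟩
      sumᵛ (λ y → q * q * factor y t) + q * q ^ X * sumᵛ (λ y → weight y t)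
        ≡⟨ cong (sumᵛ (λ y → q * q * factor y t) +_) (sym (sumᵛ-distribˡ-* (q * q ^ X) (λ y → weight y t))) ⟩
      sumᵛ (λ y → q * q * factor y t) + sumᵛ (λ y → q * q ^ X * weight y t)
        ≡⟨ sym (sumᵛ-distrib-+ (λ y → q * q * factor y t) (λ y → q * q ^ X * weight y t)) ⟩
      sumᵛ (λ y → q * q * factor y t + q * q ^ X * weight y t)
        ≤⟨ sumᵛ-mono-≤ {n} (λ y → factor-≤ y t) ⟩
      sumᵛ (λ y → q ^ X * (q * q) + q ^ X * weight y t ^ 2)
        ≡⟨ sumᵛ-distrib-+ {n} (λ y → q ^ X * (q * q)) (λ y → q ^ X * weight y t ^ 2) ⟩
      sumᵛ {n} (λ y → q ^ X * (q * q)) + sumᵛ (λ y → q ^ X * weight y t ^ 2)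
        ≡⟨ cong₂ _+_ (trans (sumᵛ-const n (q ^ X * (q * q))) (*-comm X _))
             (trans (sumᵛ-distribˡ-* (q ^ X) (λ y → weight y t ^ 2)) (cong (q ^ X *_) (sum-weight^ 2 t))) ⟩
      q ^ X * (q * q) * X + q ^ X * 5 ^ n ∎
    eq₄ : ∀ s y a b → s + y * a + y * b ≡ s + y * (a + b)
    eq₄ = solve-∀
    eq₅ : ∀ s y c q → s + y * (c * q) ≡ s + q * y * c
    eq₅ = solve-∀
    bound : q * q * s + q ^ X * (X * r * q) ≤ q ^ X * (q * q) * X
    bound = +-cancelʳ-≤ (q ^ X * 5 ^ n) _ _ (begin
      q * q * s + q ^ X * (X * r * q) + q ^ X * 5 ^ n ≡⟨ eq₄ (q * q * s) (q ^ X) (X * r * q) (5 ^ n) ⟩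
      q * q * s + q ^ X * (X * r * q + 5 ^ n)         ≤⟨ +-monoʳ-≤ (q * q * s) (*-monoʳ-≤ (q ^ X) few) ⟩
      q * q * s + q ^ X * (3 ^ n * q)                 ≡⟨ eq₅ (q * q * s) (q ^ X) (3 ^ n) q ⟩
      q * q * s + q * q ^ X * 3 ^ n                   ≤⟨ moments ⟩
      q ^ X * (q * q) * X + q ^ X * 5 ^ n             ∎)

  -- `β ^ received E t`, scaled by `q ^ X` for each entry. A target that receives little contributes
  -- much to its sum.
  potential : List (Vec Bool n) → Vec Bool n → ℕ
  potential []      t = 1
  potential (y ∷ E) t = factor y t * potential E t

  potential-received : ∀ E t → potential E t * q ^ received E t ≡ p ^ received E t * (q ^ X) ^ length E
  potential-received []      t = refl
  potential-received (y ∷ E) t = begin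
    p ^ k * z * P * q ^ (k + N)           ≡⟨ cong (p ^ k * z * P *_) (^-distribˡ-+-* q k N) ⟩
    p ^ k * z * P * (q ^ k * q ^ N)       ≡⟨ eq₁ (p ^ k) z P (q ^ k) (q ^ N) ⟩
    p ^ k * (q ^ k * z) * (P * q ^ N)     ≡⟨ cong₂ (λ a b → p ^ k * a * b) (q^k*q^[X∸k] y t) (potential-received E t) ⟩
    p ^ k * q ^ X * (p ^ N * (q ^ X) ^ length E) ≡⟨ eq₂ (p ^ k) (q ^ X) (p ^ N) _ ⟩
    p ^ k * p ^ N * (q ^ X * (q ^ X) ^ length E) ≡⟨ cong (_* (q ^ X * (q ^ X) ^ length E)) (sym (^-distribˡ-+-* p k N)) ⟩
    p ^ (k + N) * (q ^ X * (q ^ X) ^ length E) ∎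
    where
    open ≡-Reasoning
    k = weight y t
    N = received E t
    z = q ^ (X ∸ k)
    P = potential E t
    eq₁ : ∀ a z P b c → a * z * P * (b * c) ≡ a * (b * z) * (P * c)
    eq₁ = solve-∀
    eq₂ : ∀ a b c d → a * b * (c * d) ≡ a * c * (b * d)
    eq₂ = solve-∀

  -- With the sums exchanged, `sum-factor-≤` bounds the mean over `y` for each `t` separately; some
  -- `y` does no worse than the mean.
  extend : ∀ E → ∃[ y ] q ^ r * sumᵛ (potential (y ∷ E)) ≤ p ^ r * q ^ X * sumᵛ (potential E)
  extend E with y , most ← sumᵛ-≤-witness (λ y → sumᵛ (potential (y ∷ E))) =
    y , *-cancelˡ-≤ X {{m^n≢0 2 n}} (begin
    X * (q ^ r * sumᵛ (potential (y ∷ E)))                     ≡⟨ swap X (q ^ r) _ ⟩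
    q ^ r * (X * sumᵛ (potential (y ∷ E)))                     ≤⟨ *-monoʳ-≤ (q ^ r) most ⟩
    q ^ r * sumᵛ (λ y → sumᵛ (λ t → factor y t * potential E t)) ≡⟨ cong (q ^ r *_) (sumᵛ-comm (λ y t → factor y t * potential E t)) ⟩
    q ^ r * sumᵛ (λ t → sumᵛ (λ y → factor y t * potential E t)) ≡⟨ sym (sumᵛ-distribˡ-* (q ^ r) (λ t → sumᵛ (λ y → factor y t * potential E t))) ⟩
    sumᵛ (λ t → q ^ r * sumᵛ (λ y → factor y t * potential E t)) ≤⟨ sumᵛ-mono-≤ each ⟩
    sumᵛ (λ t → X * (p ^ r * q ^ X) * potential E t)           ≡⟨ sumᵛ-distribˡ-* (X * (p ^ r * q ^ X)) (potential E) ⟩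
    X * (p ^ r * q ^ X) * sumᵛ (potential E)                   ≡⟨ *-assoc X (p ^ r * q ^ X) _ ⟩
    X * (p ^ r * q ^ X * sumᵛ (potential E))                   ∎)
    where
    open ≤-Reasoning
    swap : ∀ a b c → a * (b * c) ≡ b * (a * c)
    swap = solve-∀
    each : ∀ t → q ^ r * sumᵛ (λ y → factor y t * potential E t) ≤ X * (p ^ r * q ^ X) * potential E t
    each t = begin
      q ^ r * sumᵛ (λ y → factor y t * potential E t)  ≡⟨ cong (q ^ r *_) (sumᵛ-distribʳ-* (potential E t) (λ y → factor y t)) ⟩
      q ^ r * (sumᵛ (λ y → factor y t) * potential E t) ≡⟨ sym (*-assoc (q ^ r) _ _) ⟩
      q ^ r * sumᵛ (λ y → factor y t) * potential E t  ≤⟨ *-monoˡ-≤ (potential E t) (sum-factor-≤ t) ⟩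
      X * (p ^ r * q ^ X) * potential E t              ∎

  chosen : ∀ e → ∃[ E ] length E ≡ e × (q ^ r) ^ e * sumᵛ (potential E) ≤ (p ^ r * q ^ X) ^ e * X
  chosen zero    = [] , refl , ≤-reflexive (trans (*-identityˡ _) (trans (sumᵛ-const n 1) (*-comm X 1)))
  chosen (suc e) =
    let E , len , ≤E = chosen e
        y , ≤y       = extend E
    in y ∷ E , cong suc len , chain-≤ (q ^ r) ((q ^ r) ^ e) (p ^ r * q ^ X) ((p ^ r * q ^ X) ^ e) X ≤y ≤E

  -- A single term is at most the whole sum, so `β ^ received E t ≤ 2 ^ n * β ^ (r * e)`. As
  -- `β ^ q ≤ 1/2`, the factor `2 ^ n` costs at most `n * q` in the exponent.
  received-bound : ∀ e E → length E ≡ e → (q ^ r) ^ e * sumᵛ (potential E) ≤ (p ^ r * q ^ X) ^ e * X →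
                   ∀ t → r * e ≤ received E t + n * q
  received-bound e E refl small t = ≮⇒≥ λ lt → contradiction
    -- The supposed deficit is written `suc z`: a positive exponent makes `p ^ suc z < q ^ suc z`
    -- strict.
    (cancelled (r * e ∸ suc N+nq) (trans (sym (m+[n∸m]≡n lt)) (sym (+-suc N+nq _))))
    (<⇒≱ (^-monoˡ-< (suc (r * e ∸ suc N+nq)) (n<1+n p)))
    where
    open ≤-Reasoning
    N = received E t
    N+nq = N + n * q
    eq₁ : ∀ a b X c → a * b * X * c ≡ X * a * c * b
    eq₁ = solve-∀
    averaged : q ^ (r * e) * p ^ N ≤ X * p ^ (r * e) * q ^ N
    averaged = *-cancelʳ-≤ _ _ ((q ^ X) ^ e) {{m^n≢0 (q ^ X) e {{m^n≢0 q X}}}} (begin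
      q ^ (r * e) * p ^ N * (q ^ X) ^ e            ≡⟨ *-assoc (q ^ (r * e)) _ _ ⟩
      q ^ (r * e) * (p ^ N * (q ^ X) ^ e)          ≡⟨ cong₂ _*_ (sym (^-*-assoc q r e)) (sym (potential-received E t)) ⟩
      (q ^ r) ^ e * (potential E t * q ^ N)        ≡⟨ sym (*-assoc ((q ^ r) ^ e) _ _) ⟩
      (q ^ r) ^ e * potential E t * q ^ N          ≤⟨ *-monoˡ-≤ (q ^ N) (≤-trans (*-monoʳ-≤ ((q ^ r) ^ e) (f≤sumᵛ (potential E) t)) small) ⟩
      (p ^ r * q ^ X) ^ e * X * q ^ N              ≡⟨ cong (λ a → a * X * q ^ N) (trans (^-distribʳ-* e (p ^ r) (q ^ X)) (cong (_* (q ^ X) ^ e) (^-*-assoc p r e))) ⟩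
      p ^ (r * e) * (q ^ X) ^ e * X * q ^ N        ≡⟨ eq₁ (p ^ (r * e)) _ X (q ^ N) ⟩
      X * p ^ (r * e) * q ^ N * (q ^ X) ^ e        ∎)
    2^n*p^nq≤q^nq : X * p ^ (n * q) ≤ q ^ (n * q)
    2^n*p^nq≤q^nq = begin
      X * p ^ (n * q)     ≡⟨ cong (λ k → X * p ^ k) (*-comm n q) ⟩
      X * p ^ (q * n)     ≡⟨ cong (X *_) (sym (^-*-assoc p q n)) ⟩
      X * (p ^ q) ^ n     ≡⟨ sym (^-distribʳ-* n 2 (p ^ q)) ⟩
      (2 * p ^ q) ^ n     ≤⟨ ^-monoˡ-≤ n (2*p^q≤q^q p) ⟩
      (q ^ q) ^ n         ≡⟨ ^-*-assoc q q n ⟩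
      q ^ (q * n)         ≡⟨ cong (q ^_) (*-comm q n) ⟩
      q ^ (n * q)         ∎
    split : ∀ a z → a ^ (N + n * q + z) ≡ a ^ N * a ^ (n * q) * a ^ z
    split a z = trans (^-distribˡ-+-* a (N + n * q) z) (cong (_* a ^ z) (^-distribˡ-+-* a N (n * q)))
    eq₂ : ∀ a b c d → a * b * c * d ≡ c * d * (a * b)
    eq₂ = solve-∀
    eq₃ : ∀ X a b c d → X * (a * b * c) * d ≡ X * b * (c * a * d)
    eq₃ = solve-∀
    cancelled : ∀ z → r * e ≡ N+nq + suc z → q ^ suc z ≤ p ^ suc z
    cancelled z re≡ = *-cancelʳ-≤ _ _ (p ^ N) {{m^n≢0 p N}} (*-cancelʳ-≤ _ _ (q ^ N * q ^ (n * q))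
      {{m*n≢0 (q ^ N) (q ^ (n * q)) {{m^n≢0 q N}} {{m^n≢0 q (n * q)}}}} (begin
      q ^ suc z * p ^ N * (q ^ N * q ^ (n * q))            ≡⟨ sym (eq₂ (q ^ N) (q ^ (n * q)) (q ^ suc z) (p ^ N)) ⟩
      q ^ N * q ^ (n * q) * q ^ suc z * p ^ N              ≡⟨ cong (_* p ^ N) (sym (trans (cong (q ^_) re≡) (split q (suc z)))) ⟩
      q ^ (r * e) * p ^ N                                  ≤⟨ averaged ⟩
      X * p ^ (r * e) * q ^ N                              ≡⟨ cong (λ a → X * a * q ^ N) (trans (cong (p ^_) re≡) (split p (suc z))) ⟩
      X * (p ^ N * p ^ (n * q) * p ^ suc z) * q ^ N        ≡⟨ eq₃ X (p ^ N) (p ^ (n * q)) (p ^ suc z) (q ^ N) ⟩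
      X * p ^ (n * q) * (p ^ suc z * p ^ N * q ^ N)        ≤⟨ *-monoˡ-≤ (p ^ suc z * p ^ N * q ^ N) 2^n*p^nq≤q^nq ⟩
      q ^ (n * q) * (p ^ suc z * p ^ N * q ^ N)            ≡⟨ eq₄ (q ^ (n * q)) (p ^ suc z) (p ^ N) (q ^ N) ⟩
      p ^ suc z * p ^ N * (q ^ N * q ^ (n * q))            ∎))
      where
      eq₄ : ∀ a b c d → a * (b * c * d) ≡ b * c * (d * a)
      eq₄ = solve-∀

  code : ∀ e → ∃[ E ] length E ≡ e × (∀ t → r * e ≤ received E t + n * q)
  code e with E , len , small ← chosen e = E , len , received-bound e E len small

-- Parameters of a block

-- The left side grows by `5 (1 + 1/b)^5` and the right by 6, and `(29/28)^5 < 6/5`.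
growth-step : ∀ b → 28 ≤ b → 80 * b ^ 5 * 5 ^ b ≤ 6 ^ b →
              80 * suc b ^ 5 * 5 ^ suc b ≤ 6 ^ suc b
growth-step b 28≤b growth = begin
  80 * suc b ^ 5 * (5 * 5 ^ b)       ≡⟨ eq₁ (suc b ^ 5) (5 ^ b) ⟩
  5 * suc b ^ 5 * (80 * 5 ^ b)       ≤⟨ *-monoˡ-≤ (80 * 5 ^ b) ratio ⟩
  6 * b ^ 5 * (80 * 5 ^ b)           ≡⟨ eq₂ (b ^ 5) (5 ^ b) ⟩
  6 * (80 * b ^ 5 * 5 ^ b)           ≤⟨ *-monoʳ-≤ 6 growth ⟩
  6 * 6 ^ b                          ∎
  where
  open ≤-Reasoning
  eq₁ : ∀ x y → 80 * x * (5 * y) ≡ 5 * x * (80 * y)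
  eq₁ = solve-∀
  eq₂ : ∀ x y → 6 * x * (80 * y) ≡ 6 * (80 * x * y)
  eq₂ = solve-∀
  linear : 28 * suc b ≤ 29 * b
  linear = ≤-trans (≤-reflexive (*-suc 28 b)) (+-monoˡ-≤ (28 * b) 28≤b)
  eq₃ : ∀ x y → x * (5 * y) ≡ 5 * (x * y)
  eq₃ = solve-∀
  ratio : 5 * suc b ^ 5 ≤ 6 * b ^ 5
  ratio = *-cancelˡ-≤ (28 ^ 5) (begin
    28 ^ 5 * (5 * suc b ^ 5)   ≡⟨ eq₃ (28 ^ 5) (suc b ^ 5) ⟩
    5 * (28 ^ 5 * suc b ^ 5)   ≡⟨ cong (5 *_) (sym (^-distribʳ-* 5 28 (suc b))) ⟩
    5 * (28 * suc b) ^ 5       ≤⟨ *-monoʳ-≤ 5 (^-monoˡ-≤ 5 linear) ⟩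
    5 * (29 * b) ^ 5           ≡⟨ cong (5 *_) (^-distribʳ-* 5 29 b) ⟩
    5 * (29 ^ 5 * b ^ 5)       ≡⟨ sym (*-assoc 5 (29 ^ 5) (b ^ 5)) ⟩
    5 * 29 ^ 5 * b ^ 5         ≤⟨ *-monoˡ-≤ (b ^ 5) (toWitness {a? = 5 * 29 ^ 5 ≤? 28 ^ 5 * 6} _) ⟩
    28 ^ 5 * 6 * b ^ 5         ≡⟨ *-assoc (28 ^ 5) 6 (b ^ 5) ⟩
    28 ^ 5 * (6 * b ^ 5)       ∎)

-- `(6/5) ^ b` outgrows a polynomial. The case 200 is checked by computation, and `≤′` makes the
-- induction start there.
growth : ∀ {b} → 200 ≤′ b → 80 * b ^ 5 * 5 ^ b ≤ 6 ^ b
growth ≤′-refl = toWitness {a? = 80 * 200 ^ 5 * 5 ^ 200 ≤? 6 ^ 200} _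
growth {suc b} (≤′-step 200≤b) =
  growth-step b (≤-trans (toWitness {a? = 28 ≤? 200} _) (≤′⇒≤ 200≤b)) (growth 200≤b)

^-distribʳ-*-≤ : ∀ b u v x y → u * v ≤ x * y → u ^ b * v ^ b ≤ x ^ b * y ^ b
^-distribʳ-*-≤ b u v x y uv≤xy = begin
  u ^ b * v ^ b  ≡⟨ sym (^-distribʳ-* b u v) ⟩
  (u * v) ^ b    ≤⟨ ^-monoˡ-≤ b uv≤xy ⟩
  (x * y) ^ b    ≡⟨ ^-distribʳ-* b x y ⟩
  x ^ b * y ^ b  ∎
  where open ≤-Reasoning

m≤[1+m/n]*n : ∀ m n .{{_ : NonZero n}} → m ≤ suc (m ℕ./ n) * n
m≤[1+m/n]*n m n = ≤-trans (≤-reflexive (m≡m%n+[m/n]*n m n)) (+-monoˡ-≤ (m ℕ./ n * n) (<⇒≤ (m%n<n m n)))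

-- 1/d bounds each relative loss of the code found by Greedy: q is as large as
-- b * q ≤ 2 ^ k / d allows, then r is as large as Greedy allows, then e is as
-- small as 2 ^ k ≤ r * e ∸ b * q allows.
module Parameters (k b : ℕ) (k<b : suc k ≤ b) (b≤2+k : b ≤ 2 + k) (200≤b : 200 ≤ b) where
  open ≤-Reasoning

  d : ℕ
  -- The losses combine to `(1 + 2/d)/(1 − 2/d)`. With `m = (k + 1)²` and `d = 4m` this is below
  -- `m/(m − 1) = 1 + 1/(k(k + 2))`.
  d = 4 * (suc k * suc k)

  instance
    _ = m^n≢0 2 b
    _ = m^n≢0 3 b
    _ = m^n≢0 5 b
    b-nonZero : NonZero b
    b-nonZero = >-nonZero (≤-trans (s≤s z≤n) k<b)
    bd-nonZero : NonZero (b * d)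
    bd-nonZero = m*n≢0 b d

  2^b≤4*2^k : 2 ^ b ≤ 4 * 2 ^ k
  2^b≤4*2^k = ≤-trans (^-monoʳ-≤ 2 b≤2+k) (≤-reflexive (sym (*-assoc 2 2 (2 ^ k))))

  -- `d` is at most `4b²`, so the coefficient is at most `80 b^5`, the polynomial of `growth`. The
  -- next four comparisons reduce to this one.
  4bd[1+d]5^b≤6^b : 4 * (b * d * suc d) * 5 ^ b ≤ 2 ^ b * 3 ^ b
  4bd[1+d]5^b≤6^b = begin
    4 * (b * d * suc d) * 5 ^ b                 ≤⟨ *-monoˡ-≤ (5 ^ b) (*-monoʳ-≤ 4 (*-mono-≤ (*-monoʳ-≤ b d≤4b²) 1+d≤5b²)) ⟩
    4 * (b * (4 * (b * b)) * (5 * (b * b))) * 5 ^ b  ≡⟨ cong (_* 5 ^ b) (eq b) ⟩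
    80 * b ^ 5 * 5 ^ b                          ≤⟨ growth (≤⇒≤′ 200≤b) ⟩
    6 ^ b                                       ≡⟨ ^-distribʳ-* b 2 3 ⟩
    2 ^ b * 3 ^ b                               ∎
    where
    eq : ∀ b → 4 * (b * (4 * (b * b)) * (5 * (b * b))) ≡ 80 * (b * (b * (b * (b * (b * 1)))))
    eq = solve-∀
    d≤4b² : d ≤ 4 * (b * b)
    d≤4b² = *-monoʳ-≤ 4 (*-mono-≤ k<b k<b)
    1+d≤5b² : suc d ≤ 5 * (b * b)
    1+d≤5b² = +-mono-≤ (>-nonZero⁻¹ (b * b) {{m*n≢0 b b}}) d≤4b²

  bd[1+d]5^b≤2^k3^b : b * d * (suc d * 5 ^ b) ≤ 2 ^ k * 3 ^ b
  bd[1+d]5^b≤2^k3^b = *-cancelˡ-≤ 4 (begin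
    4 * (b * d * (suc d * 5 ^ b))  ≡⟨ eq (b * d) (suc d) (5 ^ b) ⟩
    4 * (b * d * suc d) * 5 ^ b    ≤⟨ 4bd[1+d]5^b≤6^b ⟩
    2 ^ b * 3 ^ b                  ≤⟨ *-monoˡ-≤ (3 ^ b) 2^b≤4*2^k ⟩
    4 * 2 ^ k * 3 ^ b              ≡⟨ *-assoc 4 (2 ^ k) (3 ^ b) ⟩
    4 * (2 ^ k * 3 ^ b)            ∎)
    where
    eq : ∀ a c x → 4 * (a * (c * x)) ≡ 4 * (a * c) * x
    eq = solve-∀

  4d5^b≤2^b3^b : 4 * d * 5 ^ b ≤ 2 ^ b * 3 ^ b
  4d5^b≤2^b3^b = ≤-trans (*-monoˡ-≤ (5 ^ b) (*-monoʳ-≤ 4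
    (≤-trans (m≤n*m d b) (m≤m*n (b * d) (suc d))))) 4bd[1+d]5^b≤6^b

  -- Follows from `6/5 ≤ 3/2`, and bounds the loss from rounding `r` down.
  d2^b≤3^b : d * 2 ^ b ≤ 3 ^ b
  d2^b≤3^b = *-cancelʳ-≤ _ _ (5 ^ b) (begin
    d * 2 ^ b * 5 ^ b        ≡⟨ eq d (2 ^ b) (5 ^ b) ⟩
    d * 5 ^ b * 2 ^ b        ≤⟨ *-monoˡ-≤ (2 ^ b) (≤-trans (*-monoˡ-≤ (5 ^ b) (m≤n*m d 4)) 4d5^b≤2^b3^b) ⟩
    2 ^ b * 3 ^ b * 2 ^ b    ≡⟨ eq (2 ^ b) (3 ^ b) (2 ^ b) ⟩
    2 ^ b * 2 ^ b * 3 ^ b    ≤⟨ *-monoˡ-≤ (3 ^ b) (≤-trans (^-distribʳ-*-≤ b 2 2 1 5 (toWitness {a? = 4 ≤? 5} _))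
                                   (≤-reflexive (trans (cong (_* 5 ^ b) (^-zeroˡ b)) (*-identityˡ (5 ^ b))))) ⟩
    5 ^ b * 3 ^ b            ≡⟨ *-comm (5 ^ b) (3 ^ b) ⟩
    3 ^ b * 5 ^ b            ∎)
    where
    eq : ∀ x y z → x * y * z ≡ x * z * y
    eq = solve-∀

  -- Follows from `6/5 ≤ 4/3`, and bounds the loss from rounding `e` up.
  d3^b≤2^k2^b : d * 3 ^ b ≤ 2 ^ k * 2 ^ b
  d3^b≤2^k2^b = *-cancelˡ-≤ 4 (*-cancelʳ-≤ _ _ (5 ^ b) (begin
    4 * (d * 3 ^ b) * 5 ^ b        ≡⟨ eq₁ d (3 ^ b) (5 ^ b) ⟩
    4 * d * 5 ^ b * 3 ^ b          ≤⟨ *-monoˡ-≤ (3 ^ b) 4d5^b≤2^b3^b ⟩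
    2 ^ b * 3 ^ b * 3 ^ b          ≡⟨ *-assoc (2 ^ b) (3 ^ b) (3 ^ b) ⟩
    2 ^ b * (3 ^ b * 3 ^ b)        ≤⟨ *-monoʳ-≤ (2 ^ b) (^-distribʳ-*-≤ b 3 3 2 5 (toWitness {a? = 9 ≤? 10} _)) ⟩
    2 ^ b * (2 ^ b * 5 ^ b)        ≤⟨ *-monoˡ-≤ (2 ^ b * 5 ^ b) 2^b≤4*2^k ⟩
    4 * 2 ^ k * (2 ^ b * 5 ^ b)    ≡⟨ eq₂ (2 ^ k) (2 ^ b) (5 ^ b) ⟩
    4 * (2 ^ k * 2 ^ b) * 5 ^ b    ∎))
    where
    eq₁ : ∀ d x y → 4 * (d * x) * y ≡ 4 * d * y * x
    eq₁ = solve-∀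
    eq₂ : ∀ x y z → 4 * x * (y * z) ≡ 4 * (x * y) * z
    eq₂ = solve-∀

  q : ℕ
  q = 2 ^ k ℕ./ (b * d)

  qbd≤2^k : q * (b * d) ≤ 2 ^ k
  qbd≤2^k = m/n*n≤m (2 ^ k) (b * d)

  3^b≤5^b : 3 ^ b ≤ 5 ^ b
  3^b≤5^b = ^-monoˡ-≤ b (toWitness {a? = 3 ≤? 5} _)

  -- Rounding `q` down loses at most one unit, worth `3 ^ b ≤ 5 ^ b`; the extra 1 in `suc d` pays
  -- for it. The bound keeps the second-moment loss within `1/d`.
  d5^b≤q3^b : d * 5 ^ b ≤ q * 3 ^ b
  d5^b≤q3^b = +-cancelˡ-≤ (5 ^ b) _ _ (begin
    suc d * 5 ^ b      ≤⟨ *-cancelˡ-≤ (b * d) (begin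
        b * d * (suc d * 5 ^ b)  ≤⟨ bd[1+d]5^b≤2^k3^b ⟩
        2 ^ k * 3 ^ b            ≤⟨ *-monoˡ-≤ (3 ^ b) (m≤[1+m/n]*n (2 ^ k) (b * d)) ⟩
        suc q * (b * d) * 3 ^ b  ≡⟨ eq (suc q) (b * d) (3 ^ b) ⟩
        b * d * (suc q * 3 ^ b)  ∎) ⟩
    suc q * 3 ^ b      ≤⟨ +-monoˡ-≤ (q * 3 ^ b) 3^b≤5^b ⟩
    5 ^ b + q * 3 ^ b  ∎)
    where
    eq : ∀ x y z → x * y * z ≡ y * (x * z)
    eq = solve-∀

  4≤d : 4 ≤ d
  4≤d = m≤m*n 4 (suc k * suc k)

  4≤q : 4 ≤ q
  4≤q = ≤-trans 4≤d (*-cancelʳ-≤ d q (3 ^ b) (≤-trans (*-monoʳ-≤ d 3^b≤5^b) d5^b≤q3^b))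

  instance
    q-nonZero : NonZero q
    q-nonZero = >-nonZero (≤-trans (s≤s z≤n) 4≤q)
    2^b*q-nonZero : NonZero (2 ^ b * q)
    2^b*q-nonZero = m*n≢0 (2 ^ b) q

  5^b≤3^bq : 5 ^ b ≤ 3 ^ b * q
  5^b≤3^bq = ≤-trans (m≤n*m (5 ^ b) d) (≤-trans d5^b≤q3^b (≤-reflexive (*-comm q (3 ^ b))))

  r : ℕ
  r = (3 ^ b * q ∸ 5 ^ b) ℕ./ (2 ^ b * q)

  few : 2 ^ b * r * q + 5 ^ b ≤ 3 ^ b * q
  few = begin
    2 ^ b * r * q + 5 ^ b          ≡⟨ cong (_+ 5 ^ b) (eq (2 ^ b) r q) ⟩
    r * (2 ^ b * q) + 5 ^ b        ≤⟨ +-monoˡ-≤ (5 ^ b) (m/n*n≤m (3 ^ b * q ∸ 5 ^ b) (2 ^ b * q)) ⟩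
    (3 ^ b * q ∸ 5 ^ b) + 5 ^ b    ≡⟨ m∸n+n≡m 5^b≤3^bq ⟩
    3 ^ b * q                      ∎
    where
    eq : ∀ x r q → x * r * q ≡ r * (x * q)
    eq = solve-∀

  r2^b≤3^b : r * 2 ^ b ≤ 3 ^ b
  r2^b≤3^b = *-cancelʳ-≤ _ _ q (begin
    r * 2 ^ b * q          ≡⟨ cong (_* q) (*-comm r (2 ^ b)) ⟩
    2 ^ b * r * q          ≤⟨ m≤m+n _ (5 ^ b) ⟩
    2 ^ b * r * q + 5 ^ b  ≤⟨ few ⟩
    3 ^ b * q              ∎)

  -- `r` falls short of `(3/2) ^ b` by a share of at most `2/d`: one `1/d` for rounding, one for the
  -- second moment.
  d3^b≤dr2^b+2*3^b : d * 3 ^ b ≤ d * (r * 2 ^ b) + 2 * 3 ^ b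
  d3^b≤dr2^b+2*3^b = *-cancelʳ-≤ _ _ q (begin
    d * 3 ^ b * q                                     ≡⟨ *-assoc d (3 ^ b) q ⟩
    d * (3 ^ b * q)                                   ≡⟨ cong (d *_) (sym (m∸n+n≡m 5^b≤3^bq)) ⟩
    d * ((3 ^ b * q ∸ 5 ^ b) + 5 ^ b)                 ≤⟨ *-monoʳ-≤ d (+-monoˡ-≤ (5 ^ b) (m≤[1+m/n]*n (3 ^ b * q ∸ 5 ^ b) (2 ^ b * q))) ⟩
    d * (suc r * (2 ^ b * q) + 5 ^ b)                 ≡⟨ eq₁ d r (2 ^ b) q (5 ^ b) ⟩
    d * (r * 2 ^ b) * q + d * 2 ^ b * q + d * 5 ^ b   ≤⟨ +-mono-≤ (+-monoʳ-≤ (d * (r * 2 ^ b) * q) (*-monoˡ-≤ q d2^b≤3^b)) d5^b≤q3^b ⟩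
    d * (r * 2 ^ b) * q + 3 ^ b * q + q * 3 ^ b       ≡⟨ eq₂ (d * (r * 2 ^ b)) (3 ^ b) q ⟩
    (d * (r * 2 ^ b) + 2 * 3 ^ b) * q                 ∎)
    where
    eq₁ : ∀ d r x q y → d * (suc r * (x * q) + y) ≡ d * (r * x) * q + d * x * q + d * y
    eq₁ = solve-∀
    eq₂ : ∀ a y q → a * q + y * q + q * y ≡ (a + 2 * y) * q
    eq₂ = solve-∀

  instance
    r-nonZero : NonZero r
    r-nonZero = ≢-nonZero λ r≡0 → <⇒≱ (*-monoˡ-< (3 ^ b) (≤-trans (toWitness {a? = 3 ≤? 4} _) 4≤d))
      (≤-trans d3^b≤dr2^b+2*3^b (≤-reflexive (cong (_+ 2 * 3 ^ b)
        (trans (cong (λ s → d * (s * 2 ^ b)) r≡0) (*-zeroʳ d)))))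

  e : ℕ
  e = suc ((2 ^ k + b * q) ℕ./ r)

  enough : 2 ^ k + b * q ≤ r * e
  enough = ≤-trans (m≤[1+m/n]*n (2 ^ k + b * q) r) (≤-reflexive (*-comm e r))

  dr≤2^k : d * r ≤ 2 ^ k
  dr≤2^k = *-cancelʳ-≤ _ _ (2 ^ b) (begin
    d * r * 2 ^ b    ≡⟨ *-assoc d r (2 ^ b) ⟩
    d * (r * 2 ^ b)  ≤⟨ *-monoʳ-≤ d r2^b≤3^b ⟩
    d * 3 ^ b        ≤⟨ d3^b≤2^k2^b ⟩
    2 ^ k * 2 ^ b    ∎)

  -- One `1/d` is the additive loss `b * q`, the other the rounding of `e`.
  der≤[d+2]2^k : d * (e * r) ≤ (d + 2) * 2 ^ k
  der≤[d+2]2^k = begin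
    d * (r + (2 ^ k + b * q) ℕ./ r * r)     ≤⟨ *-monoʳ-≤ d (+-monoʳ-≤ r (m/n*n≤m (2 ^ k + b * q) r)) ⟩
    d * (r + (2 ^ k + b * q))             ≡⟨ eq₁ d r (2 ^ k) b q ⟩
    d * 2 ^ k + q * (b * d) + d * r       ≤⟨ +-mono-≤ (+-monoʳ-≤ (d * 2 ^ k) qbd≤2^k) dr≤2^k ⟩
    d * 2 ^ k + 2 ^ k + 2 ^ k             ≡⟨ eq₂ d (2 ^ k) ⟩
    (d + 2) * 2 ^ k                       ∎
    where
    eq₁ : ∀ d r x b q → d * (r + (x + b * q)) ≡ d * x + q * (b * d) + d * r
    eq₁ = solve-∀
    eq₂ : ∀ d x → d * x + x + x ≡ (d + 2) * x
    eq₂ = solve-∀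

  cheap : k * (2 + k) * (e * 3 ^ b) ≤ suc k * suc k * (2 ^ k * 2 ^ b)
  cheap = *-cancelʳ-≤ _ _ (d * r) {{m*n≢0 d r}} (begin
    c * (e * 3 ^ b) * (d * r)           ≡⟨ eq₁ c e (3 ^ b) d r ⟩
    c * 3 ^ b * (d * (e * r))           ≤⟨ *-monoʳ-≤ (c * 3 ^ b) der≤[d+2]2^k ⟩
    c * 3 ^ b * ((d + 2) * 2 ^ k)       ≡⟨ eq₂ c (3 ^ b) d (2 ^ k) ⟩
    c * (d + 2) * 3 ^ b * 2 ^ k         ≤⟨ *-monoˡ-≤ (2 ^ k) bound ⟩
    m * (d * (r * 2 ^ b)) * 2 ^ k       ≡⟨ eq₃ m d r (2 ^ b) (2 ^ k) ⟩
    m * (2 ^ k * 2 ^ b) * (d * r)       ∎)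
    where
    c = k * (2 + k)
    m = suc k * suc k
    eq₁ : ∀ c e y d r → c * (e * y) * (d * r) ≡ c * y * (d * (e * r))
    eq₁ = solve-∀
    eq₂ : ∀ c y d x → c * y * ((d + 2) * x) ≡ c * (d + 2) * y * x
    eq₂ = solve-∀
    eq₃ : ∀ m d r z x → m * (d * (r * z)) * x ≡ m * (x * z) * (d * r)
    eq₃ = solve-∀
    eq₄ : ∀ k y → let c = k * (2 + k); m = suc k * suc k in
          c * (4 * m + 2) * y + m * (2 * y) + 2 * y ≡ m * (4 * m * y)
    eq₄ = solve-∀
    bound : c * (d + 2) * 3 ^ b ≤ m * (d * (r * 2 ^ b))
    bound = +-cancelʳ-≤ (m * (2 * 3 ^ b)) _ _ (begin
      -- As `c = m − 1` and `d = 4m`, the added term completes the identity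
      -- `(m − 1)(4m + 2) + 2m + 2 = 4m²`.
      c * (d + 2) * 3 ^ b + m * (2 * 3 ^ b)              ≤⟨ m≤m+n _ (2 * 3 ^ b) ⟩
      c * (d + 2) * 3 ^ b + m * (2 * 3 ^ b) + 2 * 3 ^ b  ≡⟨ eq₄ k (3 ^ b) ⟩
      m * (d * 3 ^ b)                                    ≤⟨ *-monoʳ-≤ m d3^b≤dr2^b+2*3^b ⟩
      m * (d * (r * 2 ^ b) + 2 * 3 ^ b)                  ≡⟨ *-distribˡ-+ m (d * (r * 2 ^ b)) (2 * 3 ^ b) ⟩
      m * (d * (r * 2 ^ b)) + m * (2 * 3 ^ b)            ∎)

-- At the ideal size `e = 2 ^ k * (2/3) ^ b` the mean number received is exactly `2 ^ k`; `cheap`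
-- limits the excess over it to the factor `1 + 1/(k(k + 2))`.
record Admissible (k b q r e : ℕ) : Set where
  field
    few    : 2 ^ b * r * q + 5 ^ b ≤ 3 ^ b * q
    enough : 2 ^ k + b * q ≤ r * e
    cheap  : k * (2 + k) * (e * 3 ^ b) ≤ suc k * suc k * (2 ^ k * 2 ^ b)

parameters : ∀ {k b} → suc k ≤ b → b ≤ 2 + k → 200 ≤ b →
             ∃[ p ] ∃[ r ] ∃[ e ] NonZero p × Admissible k b (suc p) r e
parameters {k} {b} k<b b≤2+k 200≤b =
  predecessor q 4≤q record { few = few ; enough = enough ; cheap = cheap }
  where
  open Parameters k b k<b b≤2+k 200≤b
  predecessor : ∀ q {r e} → 4 ≤ q → Admissible k b q r e →
                ∃[ p ] ∃[ r ] ∃[ e ] NonZero p × Admissible k b (suc p) r e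
  predecessor (suc p) (s≤s 3≤p) adm = p , _ , _ , >-nonZero (≤-trans (s≤s z≤n) 3≤p) , adm

-- Induction by product with one block

-- The bound C * k / suc k, which increases to C, leaves room for a further loss
-- of 1 + 1/(k(k+2)) at the step from k to suc k.
record Efficient (C k n : ℕ) : Set where
  constructor efficient
  field
    code    : List (Vec Bool n)
    solving : Solving (2 ^ k) code
    cost    : suc k * 2 ^ k * length code * 3 ^ n ≤ C * k * 4 ^ n

-- x, y, z, u, v, w stand for 2 ^ k, 2 ^ (b ∸ suc k), 2 ^ b, 3 ^ b, 3 ^ n, 4 ^ n.
cost-step : ∀ k C s e x y z u v w .{{_ : NonZero x}} → y * (2 * x) ≡ z →
            suc k * x * s * v ≤ C * k * w →
            k * (2 + k) * (e * u) ≤ suc k * suc k * (x * z) →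
            (2 + k) * (2 * x) * (s * e * y) * (u * v) ≤ C * suc k * (z * z * w)
cost-step k C s e x y z u v w refl cost cheap = *-cancelʳ-≤ _ _ (suc k * x) {{m*n≢0 (suc k) x}} (begin
  (2 + k) * (2 * x) * (s * e * y) * (u * v) * (suc k * x)  ≡⟨ eq₁ k s e x y u v ⟩
  (2 + k) * z * e * u * (suc k * x * s * v)                ≤⟨ *-monoʳ-≤ ((2 + k) * z * e * u) cost ⟩
  (2 + k) * z * e * u * (C * k * w)                        ≡⟨ eq₂ k z e u C w ⟩
  C * w * z * (k * (2 + k) * (e * u))                      ≤⟨ *-monoʳ-≤ (C * w * z) cheap ⟩
  C * w * z * (suc k * suc k * (x * z))                    ≡⟨ eq₃ C w z k x ⟩
  C * suc k * (z * z * w) * (suc k * x)                    ∎)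
  where
  open ≤-Reasoning
  eq₁ : ∀ k s e x y u v → (2 + k) * (2 * x) * (s * e * y) * (u * v) * (suc k * x) ≡
                          (2 + k) * (y * (2 * x)) * e * u * (suc k * x * s * v)
  eq₁ = solve-∀
  eq₂ : ∀ k z e u C w → (2 + k) * z * e * u * (C * k * w) ≡ C * w * z * (k * (2 + k) * (e * u))
  eq₂ = solve-∀
  eq₃ : ∀ C w z k x → C * w * z * (suc k * suc k * (x * z)) ≡ C * suc k * (z * z * w) * (suc k * x)
  eq₃ = solve-∀

-- `2 ^ b` copies of `E ⊗ S` suffice; a factor `2 ^ i` is absorbed into the code, which leaves the
-- multiplicity `2 ^ suc k`.
efficient-⊗ : ∀ {C k n b q r e} → suc k ≤ b → Admissible k b q r e →
              ∃[ E ] length E ≡ e × (∀ t → r * e ≤ received {b} E t + b * q) →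
              Efficient C k n → Efficient C (suc k) (b + n)
efficient-⊗ {C} {k} {n} {b} {q} {r} {e} k<b adm (E , E-length , E-received) (efficient S S-solving S-cost) =
  efficient (scale (2 ^ i) (E ⊗ S)) solving cost
  where
  open Admissible adm using (enough; cheap)
  i = b ∸ suc k
  2^i*2^[1+k]≡2^b : 2 ^ i * 2 ^ suc k ≡ 2 ^ b
  2^i*2^[1+k]≡2^b = trans (sym (^-distribˡ-+-* 2 i (suc k))) (cong (2 ^_) (m∸n+n≡m k<b))
  stacking : ∀ t → scale (2 ^ b) E ⇝ replicate (2 ^ k) t
  stacking t = trans⇝ (scale⇝received E t)
    (replicate-mono t (+-cancelʳ-≤ (b * q) (2 ^ k) (received E t) (≤-trans enough (E-received t))))
  solving : Solving (2 ^ suc k) (scale (2 ^ i) (E ⊗ S))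
  solving t = subst (_⇝ t ∷ [])
    (sym (trans (scale-scale (2 ^ suc k) (2 ^ i) (E ⊗ S)) (cong (λ L → scale L (E ⊗ S)) 2^i*2^[1+k]≡2^b)))
    (⊗-solving E S stacking S-solving t)
  length≡ : length (scale (2 ^ i) (E ⊗ S)) ≡ length S * e * 2 ^ i
  length≡ = trans (length-scale (2 ^ i) (E ⊗ S))
                  (cong (_* 2 ^ i) (trans (length-⊗ E S) (cong (length S *_) E-length)))
  3^[b+n]≡3^b*3^n : 3 ^ (b + n) ≡ 3 ^ b * 3 ^ n
  3^[b+n]≡3^b*3^n = ^-distribˡ-+-* 3 b n
  4^[b+n]≡2^b*2^b*4^n : 4 ^ (b + n) ≡ 2 ^ b * 2 ^ b * 4 ^ n
  4^[b+n]≡2^b*2^b*4^n = trans (^-distribˡ-+-* 4 b n) (cong (_* 4 ^ n) (^-distribʳ-* b 2 2))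
  cost : suc (suc k) * 2 ^ suc k * length (scale (2 ^ i) (E ⊗ S)) * 3 ^ (b + n) ≤ C * suc k * 4 ^ (b + n)
  cost rewrite length≡ | 3^[b+n]≡3^b*3^n | 4^[b+n]≡2^b*2^b*4^n =
    cost-step k C (length S) e (2 ^ k) (2 ^ i) (2 ^ b) (3 ^ b) (3 ^ n) (4 ^ n) {{m^n≢0 2 k}}
      2^i*2^[1+k]≡2^b S-cost cheap

efficient-step : ∀ {C k n b} → suc k ≤ b → b ≤ 2 + k → 200 ≤ b →
                 Efficient C k n → Efficient C (suc k) (b + n)
efficient-step {b = b} k<b b≤2+k 200≤b =
  let p , r , e , p≢0 , adm = parameters k<b b≤2+k 200≤b
  in efficient-⊗ k<b adm (Greedy.code b p r {{p≢0}} (Admissible.few adm) e)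

-- A single pile of `2 ^ n` pebbles reaches every vertex. The constant is wasteful but uniform:
-- `6 ^ m` covers `2 ^ n * 3 ^ n` for every `n ≤ m`.
efficient-base : ∀ {k m n} → 1 ≤ k → n ≤ m → Efficient (suc k * 2 ^ k * 6 ^ m) k n
efficient-base {k} {m} {n} 1≤k n≤m = efficient (replicate (2 ^ n) v) solving cost
  where
  open ≤-Reasoning
  v = Vec.replicate n false
  solving : Solving (2 ^ k) (replicate (2 ^ n) v)
  solving t = trans⇝ (scale⇝ (2 ^ k) _ (m^n>0 2 k))
    (trans⇝ (replicate-weight v t) (replicate-mono {j = 1} t (weight≥1 v t)))
  cost : suc k * 2 ^ k * length (replicate (2 ^ n) v) * 3 ^ n ≤ suc k * 2 ^ k * 6 ^ m * k * 4 ^ n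
  cost = begin
    suc k * 2 ^ k * length (replicate (2 ^ n) v) * 3 ^ n ≡⟨ cong (λ l → suc k * 2 ^ k * l * 3 ^ n) (length-replicate (2 ^ n)) ⟩
    suc k * 2 ^ k * 2 ^ n * 3 ^ n    ≡⟨ *-assoc (suc k * 2 ^ k) (2 ^ n) (3 ^ n) ⟩
    suc k * 2 ^ k * (2 ^ n * 3 ^ n)  ≡⟨ cong (suc k * 2 ^ k *_) (sym (^-distribʳ-* n 2 3)) ⟩
    suc k * 2 ^ k * 6 ^ n            ≤⟨ *-monoʳ-≤ (suc k * 2 ^ k) (^-monoʳ-≤ 6 n≤m) ⟩
    suc k * 2 ^ k * 6 ^ m            ≤⟨ m≤m*n _ k {{>-nonZero 1≤k}} ⟩
    suc k * 2 ^ k * 6 ^ m * k        ≤⟨ m≤m*n _ (4 ^ n) {{m^n≢0 4 n}} ⟩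
    suc k * 2 ^ k * 6 ^ m * k * 4 ^ n ∎

-- Covering all large dimensions

-- Blocks of sizes k₀+1 , … , k add up to triangle k ∸ triangle k₀.  The lengths
-- triangle (suc k) + j with j ≤ k come from triangle k + j by a block of size
-- suc k, and the one with j = suc k comes from triangle k + k by one of size 2 + k.
triangle : ℕ → ℕ
triangle zero    = zero
triangle (suc k) = suc k + triangle k

-- Row `k` consists of the lengths `triangle k + j` with `j ≤ k`, and the next row starts one past
-- its end.
triangle-decomposition : ∀ {k₀} i → ∃₂ λ k j → k₀ ≤′ k × j ≤ k × triangle k₀ + i ≡ triangle k + j
triangle-decomposition {k₀} zero = k₀ , 0 , ≤′-refl , z≤n , refl
triangle-decomposition {k₀} (suc i) with triangle-decomposition {k₀} i
... | k , j , k₀≤k , j≤k , eq with m≤n⇒m<n∨m≡n j≤k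
...   | inj₁ j<k  = k , suc j , k₀≤k , j<k ,
                    trans (+-suc (triangle k₀) i) (trans (cong suc eq) (sym (+-suc (triangle k) j)))
...   | inj₂ refl = suc k , 0 , ≤′-step k₀≤k , z≤n ,
                    trans (+-suc (triangle k₀) i) (trans (cong suc (trans eq (+-comm (triangle k) k)))
                      (sym (+-identityʳ (suc k + triangle k))))

efficient-all : ∀ {k₀} → 200 ≤ k₀ → ∃[ C ] ∀ {k j} → k₀ ≤′ k → j ≤ k → Efficient C k (triangle k + j)
efficient-all {k₀} 200≤k₀ = C , go
  where
  -- The exponent of 6 is the largest dimension in row `k₀`, so this serves every base case; no step
  -- enlarges it.
  C = suc k₀ * 2 ^ k₀ * 6 ^ (triangle k₀ + k₀)
  go : ∀ {k j} → k₀ ≤′ k → j ≤ k → Efficient C k (triangle k + j)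
  go ≤′-refl j≤k = efficient-base (≤-trans (s≤s z≤n) 200≤k₀) (+-monoʳ-≤ (triangle k₀) j≤k)
  go {suc k} {j} (≤′-step k₀≤k) j≤1+k with m≤n⇒m<n∨m≡n j≤1+k
  ... | inj₁ j<1+k = subst (Efficient C (suc k)) (sym (+-assoc (suc k) (triangle k) j))
    (efficient-step ≤-refl (n≤1+n (suc k)) (≤-trans 200≤k₀ (m≤n⇒m≤1+n (≤′⇒≤ k₀≤k))) (go k₀≤k (s≤s⁻¹ j<1+k)))
  ... | inj₂ refl = subst (Efficient C (suc k)) (eq k (triangle k))
    (efficient-step (n≤1+n (suc k)) ≤-refl (≤-trans 200≤k₀ (m≤n⇒m≤1+n (m≤n⇒m≤1+n (≤′⇒≤ k₀≤k)))) (go k₀≤k ≤-refl))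
    where
    eq : ∀ k t → suc (suc k) + (t + k) ≡ suc k + t + suc k
    eq = solve-∀

-- Bounds on the optimal pebbling number

o : ℕ → ℕ
o n = optimalPebblingNumber (hypercube n)

o-lower : ∀ n → 4 ^ n ≤ o n * 3 ^ n
o-lower n with (D , solvable , size≡) , _ ← optimalPebblingNumber-isOptimal (hypercube n) =
  subst (λ k → 4 ^ n ≤ k * 3 ^ n) size≡ (solvable⇒4^n≤size*3^n D solvable)

efficient⇒o-upper : ∀ {C k n} → Efficient C k n → o n * 3 ^ n ≤ C * 4 ^ n
efficient⇒o-upper {C} {k} {n} (efficient S solving cost) = *-cancelˡ-≤ (suc k) (begin
  suc k * (o n * 3 ^ n)              ≤⟨ *-monoʳ-≤ (suc k) (*-monoˡ-≤ (3 ^ n) o≤) ⟩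
  suc k * (length S * 2 ^ k * 3 ^ n) ≡⟨ eq₁ k (length S) (2 ^ k) (3 ^ n) ⟩
  suc k * 2 ^ k * length S * 3 ^ n   ≤⟨ cost ⟩
  -- The factor `k / suc k` has done its work in the induction and is now bounded by 1.
  C * k * 4 ^ n                      ≤⟨ *-monoˡ-≤ (4 ^ n) (*-monoʳ-≤ C (n≤1+n k)) ⟩
  C * suc k * 4 ^ n                  ≡⟨ eq₂ C k (4 ^ n) ⟩
  suc k * (C * 4 ^ n)                ∎)
  where
  open ≤-Reasoning
  eq₁ : ∀ k s x y → suc k * (s * x * y) ≡ suc k * x * s * y
  eq₁ = solve-∀
  eq₂ : ∀ C k y → C * suc k * y ≡ suc k * (C * y)
  eq₂ = solve-∀
  o≤ : o n ≤ length S * 2 ^ k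
  o≤ = ≤-trans (proj₂ (optimalPebblingNumber-isOptimal (hypercube n)) ⟦ scale (2 ^ k) S ⟧ (λ t → ⇝⇒Reachable (solving t)))
    (≤-reflexive (trans (size-⟦⟧ (scale (2 ^ k) S)) (length-scale (2 ^ k) S)))

-- The form `suc C` makes the constant positive, as `_∈Θ_` requires.
o-upper : ∀ {k₀} → 200 ≤ k₀ → ∃₂ λ C N → ∀ n → N ≤ n → o n * 3 ^ n ≤ suc C * 4 ^ n
o-upper {k₀} 200≤k₀ with C , eff ← efficient-all 200≤k₀ = C , triangle k₀ , bound
  where
  bound : ∀ n → triangle k₀ ≤ n → o n * 3 ^ n ≤ suc C * 4 ^ n
  bound n N≤n with k , j , k₀≤k , j≤k , eq ← triangle-decomposition {k₀} (n ∸ triangle k₀)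
    with refl ← trans (sym (m+[n∸m]≡n N≤n)) eq =
    ≤-trans (efficient⇒o-upper (eff k₀≤k j≤k)) (m≤n+m _ _)

-- Passage to the rationals

open import Data.Integer.Base using (+_)
open import Data.Rational.Base using (_/_)

-- Division in `fromℕ` normalises by a gcd that is stuck on a variable; the explicit form exposes
-- the numerator.
fromℕ≡mkℚ : ∀ k → fromℕ k ≡ mkℚ (+ k) 0 (Coprimality.sym (1-coprimeTo k))
fromℕ≡mkℚ k = ℚ.normalize-coprime (Coprimality.sym (1-coprimeTo k))

fromℕ-mono-≤ : ∀ {j k} → j ≤ k → fromℕ j ℚ.≤ fromℕ k
fromℕ-mono-≤ {j} {k} j≤k rewrite fromℕ≡mkℚ j | fromℕ≡mkℚ k =
  *≤* (ℤ.*-monoʳ-≤-nonNeg (+ 1) (ℤ.+≤+ j≤k))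

fromℕ-* : ∀ j k → fromℕ (j * k) ≡ fromℕ j ℚ.* fromℕ k
fromℕ-* j k rewrite fromℕ≡mkℚ j | fromℕ≡mkℚ k = cong (λ i → i ℚ./ 1) (ℤ.pos-* j k)

fromℕ-positive : ∀ k → ℚ.Positive (fromℕ (suc k))
fromℕ-positive k rewrite fromℕ≡mkℚ (suc k) = _

[4/3]^n*3^n≡4^n : ∀ n → (+ 4 / 3) ^ℚ n ℚ.* fromℕ (3 ^ n) ≡ fromℕ (4 ^ n)
[4/3]^n*3^n≡4^n zero    = refl
[4/3]^n*3^n≡4^n (suc n) = begin
  (x ℚ.* x ^ℚ n) ℚ.* fromℕ (3 * 3 ^ n)             ≡⟨ cong (x ℚ.* x ^ℚ n ℚ.*_) (fromℕ-* 3 (3 ^ n)) ⟩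
  (x ℚ.* x ^ℚ n) ℚ.* (fromℕ 3 ℚ.* fromℕ (3 ^ n))   ≡⟨ interchange x (x ^ℚ n) (fromℕ 3) (fromℕ (3 ^ n)) ⟩
  -- The product of `x` and `fromℕ 3` computes to `fromℕ 4`.
  fromℕ 4 ℚ.* (x ^ℚ n ℚ.* fromℕ (3 ^ n))           ≡⟨ cong (fromℕ 4 ℚ.*_) ([4/3]^n*3^n≡4^n n) ⟩
  fromℕ 4 ℚ.* fromℕ (4 ^ n)                        ≡⟨ sym (fromℕ-* 4 (4 ^ n)) ⟩
  fromℕ (4 * 4 ^ n)                                ∎
  where
  open ≡-Reasoning
  open import Algebra.Properties.CommutativeSemigroup (CommutativeRing.*-commutativeSemigroup ℚ.+-*-commutativeRing)
    using (interchange)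
  x = + 4 / 3

fromℕ∈Θ[4/3]^n : ∀ (f : ℕ → ℕ) C N → (∀ n → 4 ^ n ≤ f n * 3 ^ n) →
                 (∀ n → N ≤ n → f n * 3 ^ n ≤ suc C * 4 ^ n) →
                 (λ n → fromℕ (f n)) ∈Θ (λ n → (+ 4 / 3) ^ℚ n)
fromℕ∈Θ[4/3]^n f C N lower upper =
  1ℚ , fromℕ (suc C) , ℚ.positive⁻¹ 1ℚ , ℚ.positive⁻¹ (fromℕ (suc C)) {{fromℕ-positive C}} , N , λ n N≤n →
    ℚ.*-cancelʳ-≤-pos (fromℕ (3 ^ n)) {{3^n-positive n}} (begin
      1ℚ ℚ.* g n ℚ.* fromℕ (3 ^ n)     ≡⟨ cong (ℚ._* fromℕ (3 ^ n)) (ℚ.*-identityˡ (g n)) ⟩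
      g n ℚ.* fromℕ (3 ^ n)            ≡⟨ [4/3]^n*3^n≡4^n n ⟩
      fromℕ (4 ^ n)                    ≤⟨ fromℕ-mono-≤ (lower n) ⟩
      fromℕ (f n * 3 ^ n)              ≡⟨ fromℕ-* (f n) (3 ^ n) ⟩
      fromℕ (f n) ℚ.* fromℕ (3 ^ n)    ∎)
  , ℚ.*-cancelʳ-≤-pos (fromℕ (3 ^ n)) {{3^n-positive n}} (begin
      fromℕ (f n) ℚ.* fromℕ (3 ^ n)               ≡⟨ sym (fromℕ-* (f n) (3 ^ n)) ⟩
      fromℕ (f n * 3 ^ n)                         ≤⟨ fromℕ-mono-≤ (upper n N≤n) ⟩
      fromℕ (suc C * 4 ^ n)                       ≡⟨ fromℕ-* (suc C) (4 ^ n) ⟩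
      fromℕ (suc C) ℚ.* fromℕ (4 ^ n)             ≡⟨ cong (fromℕ (suc C) ℚ.*_) (sym ([4/3]^n*3^n≡4^n n)) ⟩
      fromℕ (suc C) ℚ.* (g n ℚ.* fromℕ (3 ^ n))   ≡⟨ sym (ℚ.*-assoc (fromℕ (suc C)) (g n) (fromℕ (3 ^ n))) ⟩
      fromℕ (suc C) ℚ.* g n ℚ.* fromℕ (3 ^ n)     ∎)
  where
  open ℚ.≤-Reasoning
  g : ℕ → ℚ
  g n = (+ 4 / 3) ^ℚ n
  3^n-positive : ∀ n → ℚ.Positive (fromℕ (3 ^ n))
  3^n-positive n = subst (ℚ.Positive ∘ fromℕ) (suc-pred (3 ^ n) {{m^n≢0 3 n}}) (fromℕ-positive (pred (3 ^ n)))

theorem1 : (λ n → fromℕ (optimalPebblingNumber (hypercube n))) ∈Θ (λ n → (+ 4 / 3) ^ℚ n)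
theorem1 = let C , N , upper = o-upper (≤-refl {200}) in fromℕ∈Θ[4/3]^n o C N o-lower upper
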